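{- Let $s,t\ge 1$, $n>s+t$ and $N=n+2s+t$. Let $\alpha_{1,3}(s,t,n)$ be the number of continuous multiline queues of type $(s,t,n-s-t)$ with the largest entry $N$ in the last row and no wrapping from the second row to the third row, whose projected word $\omega$ has $\omega_1=1$ and $\omega_2=3$. Then $$\alpha_{1,3}(s,t,n)=\left(\binom{N-2}{s-1}-\binom{N-2}{s-3}\right)f_{(n-1,s+t)}.$$
   Context: A continuous multiline queue of type $(s,t,n-s-t)$ is a three-row array whose rows are strictly increasing sequences $a_1<\cdots<a_s$, $b_1<\cdots<b_{s+t}$, $c_1<\cdots<c_n$, whose $N$ entries are exactly $1,\ldots,N$, each once. Bully path procedure: initially all entries are available. First, each entry of row 1 starts a bully path; then each still-available entry of row 2 starts a bully path. An entry $x$ on a path bullies the smallest available entry of the next row larger than $x$, or, if there is none, the smallest available entry of the next row (a wrapping from that row to the next); bullied entries become unavailable and the path continues to row 3. Endpoints of paths starting in row 1 get label 1, those starting in row 2 get label 2, remaining entries of row 3 get label 3. The projected word is $\omega=(\omega_1,\ldots,\omega_n)$, $\omega_k$ the label of $c_k$. $f_{(a,b)}$ is the number of standard Young tableaux of shape $(a,b)$, equal to $\frac{a-b+1}{a+1}\binom{a+b}{a}$ for $a\ge b\ge0$. Binomial coefficients $\binom{x}{k}$ with $k<0$ are $0$. -}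

module Defs where

open import Data.Bool using (Bool; true; false; _∧_; _∨_; if_then_else_; not)
open import Data.Nat using (ℕ; zero; suc; _+_; _*_; _∸_; _<ᵇ_; _≡ᵇ_)
open import Data.Nat.DivMod using (_/_)
open import Data.Nat.Combinatorics using (_C_)
open import Data.Fin using (Fin; zero; suc)
open import Data.Fin.Properties using () renaming (_≟_ to _≟F_)
open import Data.Vec using (Vec; []; _∷_; toList)
open import Data.List using (List; []; _∷_; map; concatMap; length; filterᵇ; reverse)
open import Data.List.Membership.DecPropositional as M using ()
open import Data.Maybe using (Maybe; just; nothing)
open import Data.Product using (_×_; _,_)
open import Data.Integer using (ℤ; +_; -[1+_])
open import Relation.Nullary using (does)

-- Continuous multiline queues of type (s, t, n-s-t) on {1,…,N},
-- N = n + 2s + t.  Since each row is a strictly increasing sequence and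
-- the rows partition {1,…,N}, a queue is determined by (and determines)
-- the row of each entry.  We encode a three-row array on {1,…,N} by a
-- vector  v : Vec (Fin 3) N  where  v[i] = row of entry i+1
-- (zero = row 1, suc zero = row 2, suc (suc zero) = row 3).

row1 row2 row3 : Fin 3
row1 = zero
row2 = suc zero
row3 = suc (suc zero)

allFin3 : List (Fin 3)
allFin3 = row1 ∷ row2 ∷ row3 ∷ []

allVecs : (N : ℕ) → List (Vec (Fin 3) N)
allVecs zero    = [] ∷ []
allVecs (suc k) = concatMap (λ v → map (λ x → x ∷ v) allFin3) (allVecs k)

rowAux : ℕ → List (Fin 3) → Fin 3 → List ℕ
rowAux k []       r = []
rowAux k (x ∷ xs) r = if does (x ≟F r) then k ∷ rowAux (suc k) xs r
                                        else rowAux (suc k) xs r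

rowOf : ∀ {N} → Vec (Fin 3) N → Fin 3 → List ℕ
rowOf v r = rowAux 1 (toList v) r

hasType : ∀ {N} → ℕ → ℕ → ℕ → Vec (Fin 3) N → Bool
hasType s t n v = (length (rowOf v row1) ≡ᵇ s)
                ∧ (length (rowOf v row2) ≡ᵇ (s + t))
                ∧ (length (rowOf v row3) ≡ᵇ n)

-- Bully paths.  Available entries of a row are kept as an increasing list.

minAbove : ℕ → List ℕ → Maybe ℕ
minAbove x []       = nothing
minAbove x (y ∷ ys) = if x <ᵇ y then just y else minAbove x ys

remove : ℕ → List ℕ → List ℕ
remove y []       = []
remove y (z ∷ zs) = if y ≡ᵇ z then zs else z ∷ remove y zs

-- One bully step from x into the available list L:
-- the bullied entry, whether it was a wrapping, and the new available list.
bullyStep : ℕ → List ℕ → Maybe (ℕ × Bool × List ℕ)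
bullyStep x L with minAbove x L
... | just y  = just (y , false , remove y L)
... | nothing with L
...   | []      = nothing
...   | y ∷ ys  = just (y , true , ys)

record State : Set where
  constructor st
  field
    avail2 avail3 : List ℕ
    wrap23        : Bool
    ends1 ends2   : List ℕ

path1 : ℕ → State → Maybe State
path1 a (st A2 A3 w E1 E2) with bullyStep a A2
... | nothing = nothing
... | just (b , _ , A2') with bullyStep b A3
...   | nothing = nothing
...   | just (c , w' , A3') = just (st A2' A3' (w ∨ w') (c ∷ E1) E2)

path2 : ℕ → State → Maybe State
path2 b (st A2 A3 w E1 E2) with bullyStep b A3
... | nothing = nothing
... | just (c , w' , A3') = just (st A2 A3' (w ∨ w') E1 (c ∷ E2))

runPaths : (ℕ → State → Maybe State) → List ℕ → State → Maybe State
runPaths p []       σ = just σ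
runPaths p (x ∷ xs) σ with p x σ
... | nothing = nothing
... | just σ' = runPaths p xs σ'

bully : ∀ {N} → Vec (Fin 3) N → Maybe State
bully v with runPaths path1 (rowOf v row1)
                      (st (rowOf v row2) (rowOf v row3) false [] [])
... | nothing = nothing
... | just σ  = runPaths path2 (State.avail2 σ) (st [] (State.avail3 σ) (State.wrap23 σ) (State.ends1 σ) (State.ends2 σ))

elemᵇ : ℕ → List ℕ → Bool
elemᵇ x []       = false
elemᵇ x (y ∷ ys) = (x ≡ᵇ y) ∨ elemᵇ x ys

labelOf : State → ℕ → ℕ
labelOf σ c = if elemᵇ c (State.ends1 σ) then 1
              else if elemᵇ c (State.ends2 σ) then 2 else 3

projWord : ∀ {N} → State → Vec (Fin 3) N → List ℕ
projWord σ v = map (labelOf σ) (rowOf v row3)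

lastInRow3 : ∀ {N} → Vec (Fin 3) N → Bool
lastInRow3 v = elemᵇ (length (toList v)) (rowOf v row3)

goodRun : ∀ {N} → Vec (Fin 3) N → Bool
goodRun v with bully v
... | nothing = false
... | just σ with projWord σ v
...   | (1 ∷ 3 ∷ _) = not (State.wrap23 σ)
...   | _           = false

isCounted : ∀ {N} → ℕ → ℕ → ℕ → Vec (Fin 3) N → Bool
isCounted s t n v = hasType s t n v ∧ lastInRow3 v ∧ goodRun v

alpha13 : ℕ → ℕ → ℕ → ℕ
alpha13 s t n = length (filterᵇ (isCounted s t n) (allVecs (n + 2 * s + t)))

binomℤ : ℕ → ℤ → ℕ
binomℤ x (+ k)      = x C k
binomℤ x -[1+ _ ]   = 0

-- f_(a,b) = (a-b+1)/(a+1) * binom(a+b, a)   (for a ≥ b ≥ 0; exact division)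
fSYT : ℕ → ℕ → ℕ
fSYT a b = ((suc a ∸ b) * ((a + b) C a)) / suc a

{-# OPTIONS --safe #-}
module Submission where

-- Encode a queue as a word in a, b, c. The greedy matching of row 2 into row 3 has no wrapping iff every
-- suffix has at least as many c as b, whatever the order in which the entries bully. Then ω₁ = 1 and
-- ω₂ = 3 mean that the word without its letters a begins with bcc and that the first b is hit from row 1,
-- which fails only when the word begins with b and every suffix has at least as many b as a.
-- So the queues are counted as all words with the right bc-pattern minus certain lattice words in three
-- letters. The latter are standard Young tableaux with three rows, and expanding the determinantal formula
-- along the shortest row writes their number as C(n,i) g − (C(n,i−1) − C(n,i−2)) g′ with two-row numbers
-- g and g′; the terms with g cancel in the difference.

open import Defs
open import Data.Bool using (Bool; true; false; _∧_; _∨_; not; T)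
open import Data.Bool.Properties using (∧-zeroʳ; ∧-comm; ∧-assoc; ∨-assoc; ∨-identityʳ; ¬-not)
open import Data.Fin using (Fin; zero; suc)
open import Data.Fin.Properties using () renaming (_≟_ to _≟F_)
open import Data.Integer using (ℤ; +_; _-_; _⊖_) renaming (_*_ to _*ℤ_; _+_ to _+ℤ_)
import Data.Integer.Properties as ℤ
open import Data.Integer.Tactic.RingSolver using (solve-∀)
open import Data.List using (List; []; _∷_; length; filterᵇ; concatMap; map; _++_; _ʳ++_)
open import Data.List.Membership.Propositional using (_∈_; _∉_)
open import Data.List.Membership.Propositional.Properties using (∈-++⁺ˡ; ∈-++⁺ʳ; ∈-++⁻)
open import Data.List.Properties using (∷-injectiveˡ; ∷-injectiveʳ; length-++)
open import Data.List.Relation.Binary.Permutation.Propositional using (_↭_; refl; prep; swap; ↭-sym) renaming (trans to ↭-compose)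
open import Data.List.Relation.Binary.Permutation.Propositional.Properties using (∈-resp-↭; ↭-length)
open import Data.List.Relation.Unary.All as All using (All; []; _∷_)
open import Data.List.Relation.Unary.AllPairs as AllPairs using (AllPairs; []; _∷_)
open import Data.List.Relation.Unary.Any using (here; there)
open import Data.Maybe using (just; nothing)
open import Data.Nat using (ℕ; zero; suc; _+_; _*_; _∸_; _/_; _≤_; _<_; z≤n; s≤s; _<ᵇ_; _≤ᵇ_; _≡ᵇ_; _≟_; _!; NonZero)
open import Data.Nat.Combinatorics using (_C_; nCk+nC[k+1]≡[n+1]C[k+1]; k![n∸k]!∣n!; nCk≡n!/k![n-k]!; k>n⇒nCk≡0)
open import Data.Nat.DivMod using (m*n/n≡m; m/n*n≡m)
open import Data.Nat.Properties hiding (_≟_)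
import Data.Nat.Tactic.RingSolver as ℕ-Solver
open import Data.Product using (_×_; _,_; proj₁; proj₂; ∃; ∃₂)
open import Data.Sum using (_⊎_; inj₁; inj₂)
open import Data.Unit using (tt)
open import Data.Vec using (Vec; []; _∷_; toList)
open import Function using (_∘_)
open import Relation.Binary.PropositionalEquality using (_≡_; _≢_; refl; sym; trans; cong; cong₂; subst; subst₂; module ≡-Reasoning)
open import Relation.Nullary using (does; ¬_; contradiction; yes; no)

-- Binomial coefficients and ballot numbers

-- The prefix bcc costs nothing: behind it stand j = s + t - 1 letters b and k = n - 2 letters c
-- with j ≤ k, so its own ballot conditions hold automatically. This is why the number g′ that
-- belongs to lattice words with j letters b and k letters c is exactly f of shape (n - 1, s + t) =
-- (k + 1, j + 1). Letters a may stand anywhere but in the last place, so for the words with the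
-- right bc-pattern they contribute a single binomial coefficient. The formula for lattice words has
-- to survive the insertion of a prefix. Expanding along the row of the letters a achieves this:
-- length and number of a enter through coefficients that obey Pascal's rule, while g and g′ stay
-- constant, so each prefix letter c merely raises the length by one. On the side of the bullying,
-- the obstacle is that row 2 bullies in an order dictated by row 1. Hall's condition does not see
-- this order, and the dependence that remains is whether the first b is hit from row 1.

C-factorial : ∀ {n} k l → n ≡ k + l → (n C k) * (k ! * l !) ≡ n !
C-factorial k l refl = begin
  ((k + l) C k) * (k ! * l !)
    ≡⟨ cong (λ x → ((k + l) C k) * (k ! * x !)) (m+n∸m≡n k l) ⟨
  ((k + l) C k) * (k ! * (k + l ∸ k) !)
    ≡⟨ cong (_* (k ! * (k + l ∸ k) !)) (nCk≡n!/k![n-k]! (m≤m+n k l)) ⟩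
  _ ≡⟨ m/n*n≡m {{k !* (k + l ∸ k) !≢0}} (k![n∸k]!∣n! (m≤m+n k l)) ⟩
  (k + l) ! ∎
  where open ≡-Reasoning

nC0≡1 : ∀ n → n C 0 ≡ 1
nC0≡1 n = *-cancelʳ-≡ (n C 0) 1 (0 ! * n !) {{0 !* n !≢0}}
  (trans (C-factorial 0 n refl) (sym (trans (+-identityʳ _) (+-identityʳ _))))

infix 6.5 _C⁻_

-- The binomial coefficient n C (k − 1), which is 0 at k = 0.
_C⁻_ : ℕ → ℕ → ℕ
n C⁻ zero  = 0
n C⁻ suc k = n C k

-- By the reflection principle this counts the standard Young tableaux of shape (n - k, k) when 2k ≤
-- n. It lives in ℤ because it can be negative beyond 2k = n + 1, where the recursion `ballot-suc`
-- continues to hold.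
ballot : ℕ → ℕ → ℤ
ballot n k = + (n C k) - + (n C⁻ k)

pascal : ∀ n k → + (suc n C suc k) ≡ + (n C k) +ℤ + (n C suc k)
pascal n k = trans (cong +_ (sym (nCk+nC[k+1]≡[n+1]C[k+1] n k))) (ℤ.pos-+ (n C k) (n C suc k))

pascal⁻ : ∀ n k → + (suc n C⁻ suc k) ≡ + (n C⁻ k) +ℤ + (n C⁻ suc k)
pascal⁻ n zero    = cong +_ (trans (nC0≡1 (suc n)) (sym (nC0≡1 n)))
pascal⁻ n (suc k) = pascal n k

ballot-zero : ∀ n → ballot n 0 ≡ + 1
ballot-zero n = cong (λ x → + x - + 0) (nC0≡1 n)

ballot-suc : ∀ n k → ballot (suc n) (suc k) ≡ ballot n k +ℤ ballot n (suc k)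
ballot-suc n k = trans (cong₂ _-_ (pascal n k) (pascal⁻ n k))
  (lemma (+ (n C k)) (+ (n C suc k)) (+ (n C⁻ k)) (+ (n C⁻ suc k)))
  where
  lemma : ∀ x y u v → (x +ℤ y) - (u +ℤ v) ≡ (x - u) +ℤ (y - v)
  lemma = solve-∀

C-absorb : ∀ a b → ((b + a) C⁻ b) * suc a ≡ b * ((b + a) C b)
C-absorb a zero    = refl
C-absorb a (suc b) = *-cancelʳ-≡ _ _ (b ! * a !) {{b !* a !≢0}} (begin
  ((suc b + a) C b) * suc a * (b ! * a !)
    ≡⟨ lemma₁ ((suc b + a) C b) (suc a) (b !) (a !) ⟩
  ((suc b + a) C b) * (b ! * (suc a) !)
    ≡⟨ C-factorial b (suc a) (sym (+-suc b a)) ⟩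
  (suc b + a) !
    ≡⟨ C-factorial (suc b) a refl ⟨
  ((suc b + a) C suc b) * ((suc b) ! * a !)
    ≡⟨ lemma₂ ((suc b + a) C suc b) (suc b) (b !) (a !) ⟩
  suc b * ((suc b + a) C suc b) * (b ! * a !) ∎)
  where
  open ≡-Reasoning
  lemma₁ : ∀ c s x y → c * s * (x * y) ≡ c * (x * (s * y))
  lemma₁ = ℕ-Solver.solve-∀
  lemma₂ : ∀ c s x y → c * ((s * x) * y) ≡ s * c * (x * y)
  lemma₂ = ℕ-Solver.solve-∀

-- The hook length formula for two rows, cleared of denominators. It extends to `b = suc a`, where
-- the linear factor gives the zero of `ballot-diagonal`.
ballot-product : ∀ a b → ballot (b + a) b *ℤ + (b ! * (suc a) !) ≡ + ((b + a) !) *ℤ (+ suc a - + b)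
ballot-product a b = begin
  (+ c - + c⁻) *ℤ + (b ! * (suc a) !)
    ≡⟨ cong ((+ c - + c⁻) *ℤ_) (trans (cong +_ (shuffle (b !) (suc a) (a !))) (ℤ.pos-* (suc a) p)) ⟩
  (+ c - + c⁻) *ℤ (+ suc a *ℤ + p)
    ≡⟨ lemma₁ (+ c) (+ c⁻) (+ suc a) (+ p) ⟩
  (+ c *ℤ + suc a - + c⁻ *ℤ + suc a) *ℤ + p
    ≡⟨ cong (λ x → (+ c *ℤ + suc a - x) *ℤ + p) absorb ⟩
  (+ c *ℤ + suc a - + b *ℤ + c) *ℤ + p
    ≡⟨ lemma₂ (+ c) (+ suc a) (+ b) (+ p) ⟩
  (+ c *ℤ + p) *ℤ (+ suc a - + b)
    ≡⟨ cong (_*ℤ (+ suc a - + b)) (trans (sym (ℤ.pos-* c p)) (cong +_ (C-factorial b a refl))) ⟩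
  + ((b + a) !) *ℤ (+ suc a - + b) ∎
  where
  open ≡-Reasoning
  c c⁻ p : ℕ
  c = (b + a) C b
  c⁻ = (b + a) C⁻ b
  p = b ! * a !
  absorb : + c⁻ *ℤ + suc a ≡ + b *ℤ + c
  absorb = trans (sym (ℤ.pos-* c⁻ (suc a))) (trans (cong +_ (C-absorb a b)) (ℤ.pos-* b c))
  shuffle : ∀ x s y → x * (s * y) ≡ s * (x * y)
  shuffle = ℕ-Solver.solve-∀
  lemma₁ : ∀ x y s q → (x - y) *ℤ (s *ℤ q) ≡ (x *ℤ s - y *ℤ s) *ℤ q
  lemma₁ = solve-∀
  lemma₂ : ∀ x s y q → (x *ℤ s - y *ℤ x) *ℤ q ≡ (x *ℤ q) *ℤ (s - y)
  lemma₂ = solve-∀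

ballot-diagonal : ∀ k → ballot (suc k + k) (suc k) ≡ + 0
ballot-diagonal k = ℤ.*-cancelʳ-≡ _ (+ 0) (+ ((suc k) ! * (suc k) !)) {{(suc k) !* (suc k) !≢0}}
  (trans (ballot-product k (suc k))
    (trans (cong (+ ((suc k + k) !) *ℤ_) (ℤ.+-inverseʳ (+ suc k))) (ℤ.*-zeroʳ (+ ((suc k + k) !)))))

-- Makes the three-row numbers threeRow below vanish at i = 1 + j; both sides are
-- (1 + k − j) (1 + 2j + k)! / (j! (1 + j)! (1 + k)!).
C*ballot : ∀ k j → + ((suc j + (j + k)) C suc j) *ℤ ballot (j + k) j
               ≡ ballot (j + suc (j + k)) j *ℤ ballot (suc j + suc k) (suc j)
C*ballot k j = ℤ.*-cancelʳ-≡ _ _ (+ q) {{q≢0}} (begin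
  + c *ℤ x *ℤ + q
    ≡⟨ cong (+ c *ℤ x *ℤ_) (cong +_ q≡₁) ⟩
  + c *ℤ x *ℤ + (a₁ * a₂ * r)
    ≡⟨ cong (+ c *ℤ x *ℤ_) (pos3 a₁ a₂ r) ⟩
  + c *ℤ x *ℤ (+ a₁ *ℤ + a₂ *ℤ + r)
    ≡⟨ lemma (+ c) x (+ a₁) (+ a₂) (+ r) ⟩
  (+ c *ℤ + a₁) *ℤ (x *ℤ + a₂) *ℤ + r
    ≡⟨ cong₂ (λ u v → u *ℤ v *ℤ + r) (trans (sym (ℤ.pos-* c a₁)) (cong +_ (C-factorial (suc j) (j + k) refl)))
         (ballot-product k j) ⟩
  + (M !) *ℤ (+ ((j + k) !) *ℤ (+ suc k - + j)) *ℤ + r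
    ≡⟨ cong (λ u → + (M !) *ℤ (+ ((j + k) !) *ℤ (+ suc k - + j)) *ℤ u)
         (ℤ.pos-* (suc (suc k)) (suc (suc (j + k)) * suc (j + k))) ⟩
  + (M !) *ℤ (+ ((j + k) !) *ℤ (+ suc k - + j)) *ℤ (+ suc (suc k) *ℤ + (suc (suc (j + k)) * suc (j + k)))
    ≡⟨ lemma₃ (+ (M !)) (+ ((j + k) !)) (+ suc k - + j) (+ suc (suc k)) (+ (suc (suc (j + k)) * suc (j + k))) ⟩
  (+ (M !) *ℤ + suc (suc k)) *ℤ ((+ (suc (suc (j + k)) * suc (j + k)) *ℤ + ((j + k) !)) *ℤ (+ suc k - + j))
    ≡⟨ cong₂ (λ u v → u *ℤ v) eq₁ (cong₂ _*ℤ_ eq₂ eq₃) ⟩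
  (+ ((j + suc (j + k)) !) *ℤ (+ suc (suc (j + k)) - + j)) *ℤ (+ ((suc j + suc k) !) *ℤ (+ suc (suc k) - + suc j))
    ≡⟨ cong₂ _*ℤ_ (ballot-product (suc (j + k)) j) (ballot-product (suc k) (suc j)) ⟨
  (y *ℤ + b₁) *ℤ (z *ℤ + b₂)
    ≡⟨ lemma₂ y z (+ b₁) (+ b₂) ⟩
  y *ℤ z *ℤ (+ b₁ *ℤ + b₂)
    ≡⟨ cong (y *ℤ z *ℤ_) (ℤ.pos-* b₁ b₂) ⟨
  y *ℤ z *ℤ + q ∎)
  where
  open ≡-Reasoning
  M c a₁ a₂ r b₁ b₂ q : ℕ
  M = suc j + (j + k)
  c = M C suc j
  a₁ = (suc j) ! * (j + k) !
  a₂ = j ! * (suc k) !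
  -- The factors by which the denominators `b₁ * b₂` of the right-hand side exceed `a₁ * a₂`:
  -- `k + 2` becomes the linear factor of `y`, the other two complete (j + k)! to the factorial of
  -- `z`.
  r = suc (suc k) * (suc (suc (j + k)) * suc (j + k))
  b₁ = j ! * (suc (suc (j + k))) !
  b₂ = (suc j) ! * (suc (suc k)) !
  q = b₁ * b₂
  x y z : ℤ
  x = ballot (j + k) j
  y = ballot (j + suc (j + k)) j
  z = ballot (suc j + suc k) (suc j)
  q≢0 : NonZero q
  q≢0 = m*n≢0 b₁ b₂ {{j !* (suc (suc (j + k))) !≢0}} {{(suc j) !* (suc (suc k)) !≢0}}
  pos3 : ∀ u v w → + (u * v * w) ≡ + u *ℤ + v *ℤ + w
  pos3 u v w = trans (ℤ.pos-* (u * v) w) (cong (_*ℤ + w) (ℤ.pos-* u v))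
  q≡₁ : q ≡ a₁ * a₂ * r
  q≡₁ = reorder (j !) ((j + k) !) (suc (j + k)) (suc (suc (j + k))) ((suc j) !) ((suc k) !) (suc (suc k))
    where
    reorder : ∀ u f f₁ f₂ s t t₁ → u * (f₂ * (f₁ * f)) * (s * (t₁ * t)) ≡ s * f * (u * t) * (t₁ * (f₂ * f₁))
    reorder = ℕ-Solver.solve-∀
  lemma : ∀ c x a b r → c *ℤ x *ℤ (a *ℤ b *ℤ r) ≡ (c *ℤ a) *ℤ (x *ℤ b) *ℤ r
  lemma = solve-∀
  lemma₂ : ∀ y z b d → (y *ℤ b) *ℤ (z *ℤ d) ≡ y *ℤ z *ℤ (b *ℤ d)
  lemma₂ = solve-∀
  lemma₃ : ∀ m f d e r → m *ℤ (f *ℤ d) *ℤ (e *ℤ r) ≡ (m *ℤ e) *ℤ ((r *ℤ f) *ℤ d)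
  lemma₃ = solve-∀
  sub : ∀ u v → + u ≡ + (u + v) - + v
  sub u v = trans (lem (+ u) (+ v)) (cong (_- + v) (sym (ℤ.pos-+ u v)))
    where
    lem : ∀ p q → p ≡ (p +ℤ q) - q
    lem = solve-∀
  eq₁ : + (M !) *ℤ + suc (suc k) ≡ + ((j + suc (j + k)) !) *ℤ (+ suc (suc (j + k)) - + j)
  eq₁ = cong₂ (λ u v → + (u !) *ℤ v) (sym (+-suc j (j + k)))
    (trans (sub (suc (suc k)) j) (cong (λ u → + suc (suc u) - + j) (+-comm k j)))
  eq₂ : + (suc (suc (j + k)) * suc (j + k)) *ℤ + ((j + k) !) ≡ + ((suc j + suc k) !)
  eq₂ = trans (sym (ℤ.pos-* (suc (suc (j + k)) * suc (j + k)) ((j + k) !))) (cong +_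
    (trans (*-assoc (suc (suc (j + k))) (suc (j + k)) ((j + k) !)) (cong (λ u → (suc u) !) (sym (+-suc j k)))))
  eq₃ : + suc k - + j ≡ + suc (suc k) - + suc j
  eq₃ = trans (ℤ.m-n≡m⊖n (suc k) j) (sym (trans (ℤ.m-n≡m⊖n (suc (suc k)) (suc j)) (ℤ.[1+m]⊖[1+n]≡m⊖n (suc k) j)))

-- Multiplying by `suc a` and absorbing turns the difference of binomials into the numerator of
-- `fSYT`, so that the division there is exact; `b ≤ a` makes the truncated subtraction a genuine
-- one.
ballot≡fSYT : ∀ a b → b ≤ a → ballot (b + a) b ≡ + fSYT a b
ballot≡fSYT a b b≤a = begin
  + c - + c⁻      ≡⟨ ℤ.m-n≡m⊖n c c⁻ ⟩
  c ⊖ c⁻          ≡⟨ ℤ.⊖-≥ c⁻≤c ⟩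
  + (c ∸ c⁻)      ≡⟨ cong +_ (m*n/n≡m (c ∸ c⁻) (suc a)) ⟨
  + ((c ∸ c⁻) * suc a / suc a) ≡⟨ cong (λ x → + (x / suc a)) numerator ⟩
  + fSYT a b ∎
  where
  open ≡-Reasoning
  c c⁻ : ℕ
  c = (b + a) C b
  c⁻ = (b + a) C⁻ b
  c≡ : c ≡ (a + b) C a
  c≡ = *-cancelʳ-≡ _ _ (b ! * a !) {{b !* a !≢0}}
    (trans (C-factorial b a refl) (sym (trans (cong (((a + b) C a) *_) (*-comm (b !) (a !)))
      (trans (C-factorial a b refl) (cong _! (+-comm a b))))))
  c⁻≤c : c⁻ ≤ c
  c⁻≤c = *-cancelʳ-≤ c⁻ c (suc a) (≤-trans (≤-reflexive (C-absorb a b))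
    (≤-trans (*-monoˡ-≤ c (m≤n⇒m≤1+n b≤a)) (≤-reflexive (*-comm (suc a) c))))
  numerator : (c ∸ c⁻) * suc a ≡ (suc a ∸ b) * ((a + b) C a)
  numerator = trans (*-distribʳ-∸ (suc a) c c⁻) (trans (cong₂ _∸_ (*-comm c (suc a)) (C-absorb a b))
    (trans (sym (*-distribʳ-∸ c (suc a) b)) (cong ((suc a ∸ b) *_) c≡)))

-- Words and their enumeration

Word : Set
Word = List (Fin 3)

-- The letters a, b, c at position i say that entry i lies in row 1, 2, 3.
pattern a = zero
pattern b = suc zero
pattern c = suc (suc zero)

# : Fin 3 → Word → ℕ
# r []      = 0
# r (x ∷ w) with does (x ≟F r)
... | true  = suc (# r w)
... | false = # r w

-- Every suffix has at least as many r′ as r; only suffixes starting with r need to be checked.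
suffixBallot : Fin 3 → Fin 3 → Word → Bool
suffixBallot r r′ []      = true
suffixBallot r r′ (x ∷ w) = (not (does (x ≟F r)) ∨ (# r w <ᵇ # r′ w)) ∧ suffixBallot r r′ w

-- The junk value at [] makes endsInC (c ∷ w) and endsInC w agree for every w.
endsInC : Word → Bool
endsInC []          = true
endsInC (x ∷ [])    = does (x ≟F c)
endsInC (x ∷ y ∷ w) = endsInC (y ∷ w)

-- startsC w, startsCC w and startsBCC w say that w with all letters a erased begins with c, cc and bcc.
startsC startsCC startsBCC : Word → Bool
startsC []      = false
startsC (a ∷ w) = startsC w
startsC (b ∷ w) = false
startsC (c ∷ w) = true
startsCC []      = false
startsCC (a ∷ w) = startsCC w
startsCC (b ∷ w) = false
startsCC (c ∷ w) = startsC w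
startsBCC []      = false
startsBCC (a ∷ w) = startsBCC w
startsBCC (b ∷ w) = startsCC w
startsBCC (c ∷ w) = false

-- Read from right to left, a word in `lattice` is a Yamanouchi word in the order c, b, a, hence a
-- standard Young tableau with row lengths `# c`, `# b`, `# a`.
ballotBC lattice : Word → Bool
ballotBC w = suffixBallot b c w ∧ endsInC w
lattice w = suffixBallot a b w ∧ suffixBallot b c w

-- No wrapping into row 3 and ω₁ = 1, ω₂ = 3: c₁ is hit by the only b before c₂, and that b is
-- itself hit from row 1, either because an a precedes it or because some a wraps.
good : Word → Bool
good []      = false
good (a ∷ w) = startsBCC w ∧ suffixBallot b c w
good (b ∷ w) = (startsCC w ∧ suffixBallot b c (b ∷ w)) ∧ not (suffixBallot a b w)
good (c ∷ w) = false

-- Counting words with prescribed numbers of letters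

hasCounts : ℕ → ℕ → ℕ → Word → Bool
hasCounts i j k w = (# a w ≡ᵇ i) ∧ ((# b w ≡ᵇ j) ∧ (# c w ≡ᵇ k))

count : (Word → Bool) → ℕ → ℕ
count P N = length (filterᵇ (λ v → P (toList v)) (allVecs N))

filter-cong : ∀ {A : Set} {P Q : A → Bool} → (∀ x → P x ≡ Q x) → ∀ xs → length (filterᵇ P xs) ≡ length (filterᵇ Q xs)
filter-cong         e []       = refl
filter-cong {Q = Q} e (x ∷ xs) rewrite e x with Q x
... | true  = cong suc (filter-cong e xs)
... | false = filter-cong e xs

count-cong : ∀ (P Q : Word → Bool) N → (∀ (v : Vec (Fin 3) N) → P (toList v) ≡ Q (toList v)) → count P N ≡ count Q N
count-cong P Q N e = filter-cong e (allVecs N)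

count-zero : ∀ (P : Word → Bool) N → (∀ (v : Vec (Fin 3) N) → P (toList v) ≡ false) → count P N ≡ 0
count-zero P N e = go (allVecs N)
  where
  go : ∀ xs → length (filterᵇ (λ v → P (toList v)) xs) ≡ 0
  go []       = refl
  go (x ∷ xs) rewrite e x = go xs

count-split : ∀ (P Q : Word → Bool) N → count P N ≡ count (λ w → P w ∧ Q w) N + count (λ w → P w ∧ not (Q w)) N
count-split P Q N = go (allVecs N)
  where
  go : ∀ xs → length (filterᵇ (λ v → P (toList v)) xs)
            ≡ length (filterᵇ (λ v → P (toList v) ∧ Q (toList v)) xs)
            + length (filterᵇ (λ v → P (toList v) ∧ not (Q (toList v))) xs)
  go []       = refl
  go (x ∷ xs) with P (toList x) | Q (toList x)
  ... | true  | true  = cong suc (go xs)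
  ... | true  | false = trans (cong suc (go xs)) (sym (+-suc _ _))
  ... | false | _     = go xs

indicator : Bool → ℕ
indicator true  = 1
indicator false = 0

length-filter-∷ : ∀ {A : Set} (P : A → Bool) x xs →
  length (filterᵇ P (x ∷ xs)) ≡ indicator (P x) + length (filterᵇ P xs)
length-filter-∷ P x xs with P x
... | true  = refl
... | false = refl

count-suc : ∀ (P : Word → Bool) N → count P (suc N) ≡ count (P ∘ (a ∷_)) N +
  (count (P ∘ (b ∷_)) N + count (P ∘ (c ∷_)) N)
count-suc P N = go (allVecs N)
  where
  open ≡-Reasoning
  p : ∀ {n} → Vec (Fin 3) n → Bool
  p v = P (toList v)
  ℓ : ∀ {n} → (Vec (Fin 3) n → Bool) → List (Vec (Fin 3) n) → ℕ
  ℓ q xs = length (filterᵇ q xs)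
  extend : List (Vec (Fin 3) N) → List (Vec (Fin 3) (suc N))
  extend = concatMap (λ v → map (λ x → x ∷ v) allFin3)
  regroup : ∀ x y z u v w → x + (y + (z + (u + (v + w)))) ≡ (x + u) + ((y + v) + (z + w))
  regroup = ℕ-Solver.solve-∀
  go : ∀ xs → ℓ p (extend xs) ≡ ℓ (p ∘ (a ∷_)) xs + (ℓ (p ∘ (b ∷_)) xs + ℓ (p ∘ (c ∷_)) xs)
  go []       = refl
  go (v ∷ xs) = begin
    ℓ p ((a ∷ v) ∷ (b ∷ v) ∷ (c ∷ v) ∷ extend xs)
      ≡⟨ length-filter-∷ p (a ∷ v) _ ⟩
    [a] + ℓ p ((b ∷ v) ∷ (c ∷ v) ∷ extend xs)
      ≡⟨ cong (_+_ [a]) (length-filter-∷ p (b ∷ v) _) ⟩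
    [a] + ([b] + ℓ p ((c ∷ v) ∷ extend xs))
      ≡⟨ cong (λ n → [a] + ([b] + n)) (length-filter-∷ p (c ∷ v) _) ⟩
    [a] + ([b] + ([c] + ℓ p (extend xs)))
      ≡⟨ cong (λ n → [a] + ([b] + ([c] + n))) (go xs) ⟩
    [a] + ([b] + ([c] + (ℓ (p ∘ (a ∷_)) xs + (ℓ (p ∘ (b ∷_)) xs + ℓ (p ∘ (c ∷_)) xs))))
      ≡⟨ regroup [a] [b] [c] (ℓ (p ∘ (a ∷_)) xs) (ℓ (p ∘ (b ∷_)) xs) (ℓ (p ∘ (c ∷_)) xs) ⟩
    ([a] + ℓ (p ∘ (a ∷_)) xs) + (([b] + ℓ (p ∘ (b ∷_)) xs) + ([c] + ℓ (p ∘ (c ∷_)) xs))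
      ≡⟨ cong₂ _+_ (length-filter-∷ (p ∘ (a ∷_)) v xs)
           (cong₂ _+_ (length-filter-∷ (p ∘ (b ∷_)) v xs) (length-filter-∷ (p ∘ (c ∷_)) v xs)) ⟨
    ℓ (p ∘ (a ∷_)) (v ∷ xs) + (ℓ (p ∘ (b ∷_)) (v ∷ xs) + ℓ (p ∘ (c ∷_)) (v ∷ xs)) ∎
    where
    [a] [b] [c] : ℕ
    [a] = indicator (p (a ∷ v))
    [b] = indicator (p (b ∷ v))
    [c] = indicator (p (c ∷ v))

≡ᵇ-true⇒≡ : ∀ m n → (m ≡ᵇ n) ≡ true → m ≡ n
≡ᵇ-true⇒≡ m n e = ≡ᵇ⇒≡ m n (subst T (sym e) tt)

∧-true⇒ : ∀ p q → p ∧ q ≡ true → p ≡ true × q ≡ true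
∧-true⇒ true true _ = refl , refl

hasCounts⇒≡ : ∀ i j k w → hasCounts i j k w ≡ true → # a w ≡ i × # b w ≡ j × # c w ≡ k
hasCounts⇒≡ i j k w e with ∧-true⇒ (# a w ≡ᵇ i) _ e
... | e₁ , e′ with ∧-true⇒ (# b w ≡ᵇ j) _ e′
...   | e₂ , e₃ = ≡ᵇ-true⇒≡ _ i e₁ , ≡ᵇ-true⇒≡ _ j e₂ , ≡ᵇ-true⇒≡ _ k e₃

countOf : (Word → Bool) → ℕ → ℕ → ℕ → ℕ → ℕ
countOf Q i j k = count (λ w → hasCounts i j k w ∧ Q w)

countOf-cong : ∀ (P Q : Word → Bool) i j k N →
  (∀ (v : Vec (Fin 3) N) → let w = toList v in # a w ≡ i → # b w ≡ j → # c w ≡ k → P w ≡ Q w) →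
  countOf P i j k N ≡ countOf Q i j k N
countOf-cong P Q i j k N e = count-cong (λ w → hasCounts i j k w ∧ P w) (λ w → hasCounts i j k w ∧ Q w) N pointwise
  where
  pointwise : ∀ (v : Vec (Fin 3) N) → hasCounts i j k (toList v) ∧ P (toList v) ≡ hasCounts i j k (toList v) ∧ Q
    (toList v)
  pointwise v with hasCounts i j k (toList v) in eq
  ... | false = refl
  ... | true with hasCounts⇒≡ i j k (toList v) eq
  ...   | p , q , r = e v p q r

countOf-zero : ∀ (P : Word → Bool) i j k N →
  (∀ (v : Vec (Fin 3) N) → let w = toList v in # a w ≡ i → # b w ≡ j → # c w ≡ k → P w ≡ false) →
  countOf P i j k N ≡ 0
countOf-zero P i j k N e = trans (countOf-cong P (λ _ → false) i j k N e)
  (count-zero (λ w → hasCounts i j k w ∧ false) N (λ v → ∧-zeroʳ (hasCounts i j k (toList v))))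

-- The value 0 at `zero` expresses that no word starts with a letter it does not contain.
pre : (ℕ → ℕ) → ℕ → ℕ
pre f zero    = 0
pre f (suc i) = f i

countOf-suc : ∀ Q i j k N → countOf Q i j k (suc N) ≡
  pre (λ i′ → countOf (Q ∘ (a ∷_)) i′ j k N) i +
    (pre (λ j′ → countOf (Q ∘ (b ∷_)) i j′ k N) j + pre (λ k′ → countOf (Q ∘ (c ∷_)) i j k′ N) k)
countOf-suc Q i j k N = trans (count-suc (λ w → hasCounts i j k w ∧ Q w) N)
  (cong₂ _+_ (first i) (cong₂ _+_ (second j) (third k)))
  where
  first : ∀ i → count (λ w → hasCounts i j k (a ∷ w) ∧ Q (a ∷ w)) N ≡ pre (λ i′ → countOf (Q ∘ (a ∷_)) i′ j k N) i
  first zero    = count-zero (λ w → hasCounts 0 j k (a ∷ w) ∧ Q (a ∷ w)) N (λ v → refl)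
  first (suc i) = refl
  second : ∀ j → count (λ w → hasCounts i j k (b ∷ w) ∧ Q (b ∷ w)) N ≡ pre (λ j′ → countOf (Q ∘ (b ∷_)) i j′ k N) j
  second zero    = count-zero (λ w → hasCounts i 0 k (b ∷ w) ∧ Q (b ∷ w)) N
    (λ v → cong (_∧ Q (b ∷ toList v)) (∧-zeroʳ (# a (toList v) ≡ᵇ i)))
  second (suc j) = refl
  third : ∀ k → count (λ w → hasCounts i j k (c ∷ w) ∧ Q (c ∷ w)) N ≡ pre (λ k′ → countOf (Q ∘ (c ∷_)) i j k′ N) k
  third zero    = count-zero (λ w → hasCounts i j 0 (c ∷ w) ∧ Q (c ∷ w)) N (λ v → cong (_∧ Q (c ∷ toList v))
    (trans (cong ((# a (toList v) ≡ᵇ i) ∧_) (∧-zeroʳ (# b (toList v) ≡ᵇ j))) (∧-zeroʳ (# a (toList v) ≡ᵇ i))))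
  third (suc k) = refl

-- Ballot conditions and the effect of a leading letter

<⇒<ᵇ-true : ∀ {m n} → m < n → (m <ᵇ n) ≡ true
<⇒<ᵇ-true {m} {n} m<n with m <ᵇ n | <⇒<ᵇ m<n
... | true | _ = refl

<ᵇ-true⇒< : ∀ {m n} → (m <ᵇ n) ≡ true → m < n
<ᵇ-true⇒< {m} {n} e = <ᵇ⇒< m n (subst T (sym e) tt)

ballotAB⇒#≤# : ∀ w → suffixBallot a b w ≡ true → # a w ≤ # b w
ballotAB⇒#≤# []      _ = z≤n
ballotAB⇒#≤# (a ∷ w) e = <ᵇ-true⇒< (proj₁ (∧-true⇒ _ _ e))
ballotAB⇒#≤# (b ∷ w) e = m≤n⇒m≤1+n (ballotAB⇒#≤# w e)
ballotAB⇒#≤# (c ∷ w) e = ballotAB⇒#≤# w e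

ballotBC⇒#≤# : ∀ w → suffixBallot b c w ≡ true → # b w ≤ # c w
ballotBC⇒#≤# []      _ = z≤n
ballotBC⇒#≤# (a ∷ w) e = ballotBC⇒#≤# w e
ballotBC⇒#≤# (b ∷ w) e = <ᵇ-true⇒< (proj₁ (∧-true⇒ _ _ e))
ballotBC⇒#≤# (c ∷ w) e = m≤n⇒m≤1+n (ballotBC⇒#≤# w e)

ballotAB-false : ∀ {i j} w → # a w ≡ i → # b w ≡ j → j < i → suffixBallot a b w ≡ false
ballotAB-false w refl refl j<i = ¬-not {y = true} (λ e → <⇒≱ j<i (ballotAB⇒#≤# w e))

ballotBC-false : ∀ {j k} w → # b w ≡ j → # c w ≡ k → k < j → suffixBallot b c w ≡ false
ballotBC-false w refl refl k<j = ¬-not {y = true} (λ e → <⇒≱ k<j (ballotBC⇒#≤# w e))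

-- The only new suffix is the whole word, and its condition depends on the counts alone. Once the
-- counts are fixed, a leading letter therefore restricts nothing inside the ballot region.
ballotAB-a : ∀ {i j} w → # a w ≡ i → # b w ≡ j → i < j → suffixBallot a b (a ∷ w) ≡ suffixBallot a b w
ballotAB-a w refl refl i<j rewrite <⇒<ᵇ-true i<j = refl

ballotBC-b : ∀ {j k} w → # b w ≡ j → # c w ≡ k → j < k → suffixBallot b c (b ∷ w) ≡ suffixBallot b c w
ballotBC-b w refl refl j<k rewrite <⇒<ᵇ-true j<k = refl

endsInC-c : ∀ w → endsInC (c ∷ w) ≡ endsInC w
endsInC-c []      = refl
endsInC-c (_ ∷ _) = refl

-- A one-letter suffix a or b already violates one of the two conditions.
lattice⇒endsInC : ∀ w → suffixBallot a b w ≡ true → suffixBallot b c w ≡ true → endsInC w ≡ true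
lattice⇒endsInC []          _  _  = refl
lattice⇒endsInC (c ∷ [])    _  _  = refl
lattice⇒endsInC (x ∷ y ∷ w) e₁ e₂ = lattice⇒endsInC (y ∷ w) (tail-true a b e₁) (tail-true b c e₂)
  where
  tail-true : ∀ r r′ → suffixBallot r r′ (x ∷ y ∷ w) ≡ true → suffixBallot r r′ (y ∷ w) ≡ true
  tail-true r r′ e = proj₂ (∧-true⇒ (not (does (x ≟F r)) ∨ (# r (y ∷ w) <ᵇ # r′ (y ∷ w))) _ e)

-- Words that are ballot in b and c and end in c

words-ballotBC₁ : ∀ i j k → i + j + k ≡ 1 → j ≤ k → + countOf ballotBC i j k 1 ≡ + (0 C i) *ℤ ballot (j + k) j
words-ballotBC₁ zero       zero    k       refl _        = refl
words-ballotBC₁ zero       (suc j) (suc k) eq   _        = contradiction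
  (trans (sym (+-suc j k)) (suc-injective eq)) λ ()
words-ballotBC₁ (suc zero) zero    zero    refl _        = refl

-- As the last letter is c, the letters a occupy any `i` of the first `M` places, and the others
-- form an arbitrary ballot word. The case `j ≡ suc k`, where both sides vanish, is included so that
-- the induction can remove a c at `j ≡ k`.
words-ballotBC : ∀ M i j k → i + j + k ≡ suc M → j ≤ suc k →
  + countOf ballotBC i j k (suc M) ≡ + (M C i) *ℤ ballot (j + k) j
words-ballotBC M i j k eq j≤1+k with m≤n⇒m<n∨m≡n j≤1+k
words-ballotBC M i j k eq j≤1+k | inj₂ refl = trans
  (cong +_ (countOf-zero ballotBC i (suc k) k (suc M)
    (λ v _ p q → cong (_∧ endsInC (toList v)) (ballotBC-false (toList v) p q ≤-refl))))
  (sym (trans (cong (+ (M C i) *ℤ_) (ballot-diagonal k)) (ℤ.*-zeroʳ (+ (M C i)))))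
words-ballotBC zero    i j k eq j≤1+k | inj₁ (s≤s j≤k) = words-ballotBC₁ i j k eq j≤k
words-ballotBC (suc M) i j k eq j≤1+k | inj₁ (s≤s j≤k) = begin
  + countOf ballotBC i j k (suc (suc M))
    ≡⟨ cong +_ (countOf-suc ballotBC i j k (suc M)) ⟩
  + (pa i + (pb j + pc k))
    ≡⟨ ℤ.pos-+ (pa i) (pb j + pc k) ⟩
  + pa i +ℤ + (pb j + pc k)
    ≡⟨ cong₂ _+ℤ_ (first i eq) (rest j k eq j≤k) ⟩
  + (M C⁻ i) *ℤ g +ℤ + (M C i) *ℤ g
    ≡⟨ ℤ.*-distribʳ-+ g (+ (M C⁻ i)) (+ (M C i)) ⟨
  (+ (M C⁻ i) +ℤ + (M C i)) *ℤ g
    ≡⟨ cong (_*ℤ g) (pascal⁻ M i) ⟨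
  + (suc M C i) *ℤ g ∎
  where
  open ≡-Reasoning
  pa pb pc : ℕ → ℕ
  pa = pre (λ i′ → countOf (ballotBC ∘ (a ∷_)) i′ j k (suc M))
  pb = pre (λ j′ → countOf (ballotBC ∘ (b ∷_)) i j′ k (suc M))
  pc = pre (λ k′ → countOf (ballotBC ∘ (c ∷_)) i j k′ (suc M))
  g : ℤ
  g = ballot (j + k) j
  first : ∀ i → i + j + k ≡ suc (suc M) →
    + pre (λ i′ → countOf (ballotBC ∘ (a ∷_)) i′ j k (suc M)) i ≡ + (M C⁻ i) *ℤ g
  first zero    _  = refl
  first (suc i) eq = trans (cong +_ (countOf-cong (ballotBC ∘ (a ∷_)) ballotBC i j k (suc M)
    (λ { (_ ∷ _) _ _ _ → refl }))) (words-ballotBC M i j k (suc-injective eq) j≤1+k)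
  partC : ∀ j k → i + j + suc k ≡ suc (suc M) → j ≤ suc k →
    + countOf (ballotBC ∘ (c ∷_)) i j k (suc M) ≡ + (M C i) *ℤ ballot (j + k) j
  partC j k eq le = trans (cong +_ (countOf-cong (ballotBC ∘ (c ∷_)) ballotBC i j k (suc M)
    (λ v _ _ _ → cong (suffixBallot b c (toList v) ∧_) (endsInC-c (toList v)))))
    (words-ballotBC M i j k (suc-injective (trans (sym (+-suc (i + j) k)) eq)) le)
  partB : ∀ j k → i + suc j + k ≡ suc (suc M) → suc j ≤ k →
    + countOf (ballotBC ∘ (b ∷_)) i j k (suc M) ≡ + (M C i) *ℤ ballot (j + k) j
  partB j k eq le = trans (cong +_ (countOf-cong (ballotBC ∘ (b ∷_)) ballotBC i j k (suc M)
    (λ { v@(_ ∷ _) _ p q → cong (_∧ endsInC (toList v)) (ballotBC-b (toList v) p q le) })))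
    (words-ballotBC M i j k (suc-injective (trans (cong (_+ k) (sym (+-suc i j))) eq)) (m≤n⇒m≤1+n (<⇒≤ le)))
  rest : ∀ j k → i + j + k ≡ suc (suc M) → j ≤ k →
    + (pre (λ j′ → countOf (ballotBC ∘ (b ∷_)) i j′ k (suc M)) j
      + pre (λ k′ → countOf (ballotBC ∘ (c ∷_)) i j k′ (suc M)) k) ≡ + (M C i) *ℤ ballot (j + k) j
  -- All letters are a, so `i` is `2 + M` and `M C i` vanishes, in accordance with the missing final
  -- c.
  rest zero zero eq _ = sym (cong (λ x → + x *ℤ + 1)
    (k>n⇒nCk≡0 {M} {i} (subst (M <_) (trans (sym eq) (trans (+-identityʳ _) (+-identityʳ i))) (m≤n⇒m≤1+n ≤-refl))))
  rest zero (suc k) eq _ = trans (partC zero k eq z≤n)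
    (cong (+ (M C i) *ℤ_) (trans (ballot-zero k) (sym (ballot-zero (suc k)))))
  rest (suc j) (suc k) eq (s≤s le) = begin
    + (countOf (ballotBC ∘ (b ∷_)) i j (suc k) (suc M) + countOf (ballotBC ∘ (c ∷_)) i (suc j) k (suc M))
      ≡⟨ ℤ.pos-+ (countOf (ballotBC ∘ (b ∷_)) i j (suc k) (suc M)) (countOf (ballotBC ∘ (c ∷_)) i (suc j) k (suc M)) ⟩
    + countOf (ballotBC ∘ (b ∷_)) i j (suc k) (suc M) +ℤ + countOf (ballotBC ∘ (c ∷_)) i (suc j) k (suc M)
      ≡⟨ cong₂ _+ℤ_ (partB j (suc k) eq (s≤s le)) (partC (suc j) k eq (s≤s le)) ⟩
    + (M C i) *ℤ ballot (j + suc k) j +ℤ + (M C i) *ℤ ballot (suc j + k) (suc j)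
      ≡⟨ cong (λ x → + (M C i) *ℤ ballot (j + suc k) j +ℤ + (M C i) *ℤ ballot x (suc j)) (+-suc j k) ⟨
    + (M C i) *ℤ ballot (j + suc k) j +ℤ + (M C i) *ℤ ballot (j + suc k) (suc j)
      ≡⟨ ℤ.*-distribˡ-+ (+ (M C i)) (ballot (j + suc k) j) (ballot (j + suc k) (suc j)) ⟨
    + (M C i) *ℤ (ballot (j + suc k) j +ℤ ballot (j + suc k) (suc j))
      ≡⟨ cong (+ (M C i) *ℤ_) (ballot-suc (j + suc k) j) ⟨
    + (M C i) *ℤ ballot (suc j + suc k) (suc j) ∎

-- Three-row numbers and lattice words

ballot⁻ : ℕ → ℕ → ℤ
ballot⁻ n zero    = + 0
ballot⁻ n (suc k) = ballot n k

ballot⁻-suc : ∀ n k → ballot⁻ (suc n) (suc k) ≡ ballot⁻ n k +ℤ ballot⁻ n (suc k)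
ballot⁻-suc n zero    = trans (ballot-zero (suc n)) (sym (trans (ℤ.+-identityˡ (ballot n 0)) (ballot-zero n)))
ballot⁻-suc n (suc k) = ballot-suc n k

-- At g = ballot (j + k) j and g′ = ballot (2 + j + k) (1 + j) this is, for n = i + j + k,
-- the number of standard Young tableaux of shape (k, j, i): Frobenius' determinant expanded along its last row.
expansion : ℤ → ℤ → ℕ → ℕ → ℤ
expansion g g′ n i = + (n C i) *ℤ g - ballot⁻ n i *ℤ g′

expansion-zero : ∀ g g′ n → expansion g g′ n 0 ≡ g
expansion-zero g g′ n = trans (cong (λ x → + x *ℤ g - + 0 *ℤ g′) (nC0≡1 n)) (lemma g g′)
  where
  lemma : ∀ x y → + 1 *ℤ x - + 0 *ℤ y ≡ x
  lemma = solve-∀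

expansion-suc : ∀ g g′ n i → expansion g g′ (suc n) (suc i) ≡ expansion g g′ n i +ℤ expansion g g′ n (suc i)
expansion-suc g g′ n i = trans (cong₂ (λ x y → x *ℤ g - y *ℤ g′) (pascal n i) (ballot⁻-suc n i))
  (lemma (+ (n C i)) (+ (n C suc i)) (ballot⁻ n i) (ballot⁻ n (suc i)) g g′)
  where
  lemma : ∀ x y u v p q → (x +ℤ y) *ℤ p - (u +ℤ v) *ℤ q ≡ (x *ℤ p - u *ℤ q) +ℤ (y *ℤ p - v *ℤ q)
  lemma = solve-∀

expansion-additive : ∀ x y u v n i → expansion (x +ℤ y) (u +ℤ v) n i ≡ expansion x u n i +ℤ expansion y v n i
expansion-additive x y u v n i = lemma (+ (n C i)) (ballot⁻ n i) x y u v
  where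
  lemma : ∀ p q x y u v → p *ℤ (x +ℤ y) - q *ℤ (u +ℤ v) ≡ (p *ℤ x - q *ℤ u) +ℤ (p *ℤ y - q *ℤ v)
  lemma = solve-∀

-- The length is kept independent of `i + j + k`: for words with a prefix it also includes the
-- prefix letters c, while `j` and `k` describe what follows the prefix.
threeRow : ℕ → ℕ → ℕ → ℕ → ℤ
threeRow j k = expansion (ballot (j + k) j) (ballot (suc j + suc k) (suc j))

threeRow-zero : ∀ j k n → threeRow j k n 0 ≡ ballot (j + k) j
threeRow-zero j k = expansion-zero (ballot (j + k) j) (ballot (suc j + suc k) (suc j))

threeRow-suc : ∀ j k n i → threeRow j k (suc n) (suc i) ≡ threeRow j k n i +ℤ threeRow j k n (suc i)
threeRow-suc j k = expansion-suc (ballot (j + k) j) (ballot (suc j + suc k) (suc j))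

-- This mirrors the choice between b and c as first letter: both coefficients obey the ballot
-- recursion, and `expansion` is linear in them.
threeRow-split : ∀ j k n i → threeRow (suc j) (suc k) n i ≡ threeRow j (suc k) n i +ℤ threeRow (suc j) k n i
threeRow-split j k n i = trans
  (cong₂ (λ x y → expansion x y n i)
    (trans (ballot-suc (j + suc k) j) (cong (λ x → ballot (j + suc k) j +ℤ ballot x (suc j)) (+-suc j k)))
    (trans (ballot-suc (suc j + suc (suc k)) (suc j))
      (cong (λ x → ballot (suc j + suc (suc k)) (suc j) +ℤ ballot x (suc (suc j))) (+-suc (suc j) (suc k)))))
  (expansion-additive (ballot (j + suc k) j) _ (ballot (suc j + suc (suc k)) (suc j)) _ n i)

threeRow-i≡1+j : ∀ j k n → suc j + j + k ≡ n → threeRow j k n (suc j) ≡ + 0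
threeRow-i≡1+j j k n refl = trans
  (cong₂ (λ x y → + (x C suc j) *ℤ ballot (j + k) j - ballot y j *ℤ g′) (+-assoc (suc j) j k)
    (trans (+-assoc (suc j) j k) (sym (+-suc j (j + k)))))
  (trans (cong (_- ballot (j + suc (j + k)) j *ℤ g′) (C*ballot k j))
    (ℤ.+-inverseʳ (ballot (j + suc (j + k)) j *ℤ g′)))
  where
  g′ = ballot (suc j + suc k) (suc j)

threeRow-j≡1+k : ∀ k n i → threeRow (suc k) k n i ≡ + 0
threeRow-j≡1+k k n i = trans (cong₂ (λ x y → expansion x y n i) (ballot-diagonal k) (ballot-diagonal (suc k)))
  (lemma (+ (n C i)) (ballot⁻ n i))
  where
  lemma : ∀ x y → x *ℤ + 0 - y *ℤ + 0 ≡ + 0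
  lemma = solve-∀

-- Both sides obey the recursion over the first letter and vanish on the walls `i ≡ suc j` and
-- `j ≡ suc k`. The walls belong to the range because removing a b at `i ≡ j` or a c at `j ≡ k`
-- leads onto them.
words-lattice : ∀ N i j k → i + j + k ≡ N → i ≤ suc j → j ≤ suc k → + countOf lattice i j k N ≡ threeRow j k N i
words-lattice N i j k eq i≤1+j j≤1+k with m≤n⇒m<n∨m≡n i≤1+j | m≤n⇒m<n∨m≡n j≤1+k
words-lattice N i j k eq _ _ | inj₂ refl | _ = trans
  (cong +_ (countOf-zero lattice (suc j) j k N
    (λ v p q _ → cong (_∧ suffixBallot b c (toList v)) (ballotAB-false (toList v) p q ≤-refl))))
  (sym (threeRow-i≡1+j j k N eq))
words-lattice N i j k eq _ _ | inj₁ _ | inj₂ refl = trans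
  (cong +_ (countOf-zero lattice i (suc k) k N
    (λ v _ p q → trans (cong (suffixBallot a b (toList v) ∧_) (ballotBC-false (toList v) p q ≤-refl))
      (∧-zeroʳ (suffixBallot a b (toList v))))))
  (sym (threeRow-j≡1+k k N i))
words-lattice zero zero zero zero refl _ _ | inj₁ _ | inj₁ _ = refl
words-lattice (suc N) i j k eq i≤1+j j≤1+k | inj₁ (s≤s i≤j) | inj₁ (s≤s j≤k) =
  trans (cong +_ (countOf-suc lattice i j k N)) (cases i j k eq i≤j j≤k)
  where
  partA : ∀ i j k → suc i + j + k ≡ suc N → suc i ≤ j → j ≤ k →
    + countOf (lattice ∘ (a ∷_)) i j k N ≡ threeRow j k N i
  partA i j k eq i<j j≤k = trans
    (cong +_ (countOf-cong (lattice ∘ (a ∷_)) lattice i j k N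
      (λ v p q _ → cong (_∧ suffixBallot b c (toList v)) (ballotAB-a (toList v) p q i<j))))
    (words-lattice N i j k (suc-injective eq) (m≤n⇒m≤1+n (<⇒≤ i<j)) (m≤n⇒m≤1+n j≤k))
  partB : ∀ i j k → i + suc j + k ≡ suc N → i ≤ suc j → suc j ≤ k →
    + countOf (lattice ∘ (b ∷_)) i j k N ≡ threeRow j k N i
  partB i j k eq i≤1+j j<k = trans
    (cong +_ (countOf-cong (lattice ∘ (b ∷_)) lattice i j k N
      (λ v _ p q → cong (suffixBallot a b (toList v) ∧_) (ballotBC-b (toList v) p q j<k))))
    (words-lattice N i j k (suc-injective (trans (cong (_+ k) (sym (+-suc i j))) eq)) i≤1+j (m≤n⇒m≤1+n (<⇒≤ j<k)))
  partC : ∀ i j k → i + j + suc k ≡ suc N → i ≤ j → j ≤ suc k →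
    + countOf (lattice ∘ (c ∷_)) i j k N ≡ threeRow j k N i
  partC i j k eq i≤j j≤1+k = words-lattice N i j k (suc-injective (trans (sym (+-suc (i + j) k)) eq))
    (m≤n⇒m≤1+n i≤j) j≤1+k
  partBC : ∀ i j k → i + suc j + suc k ≡ suc N → i ≤ suc j → j ≤ k →
    + (countOf (lattice ∘ (b ∷_)) i j (suc k) N + countOf (lattice ∘ (c ∷_)) i (suc j) k N)
    ≡ threeRow (suc j) (suc k) N i
  partBC i j k eq i≤1+j j≤k = trans (ℤ.pos-+ (countOf (lattice ∘ (b ∷_)) i j (suc k) N)
    (countOf (lattice ∘ (c ∷_)) i (suc j) k N))
    (trans (cong₂ _+ℤ_ (partB i j (suc k) eq i≤1+j (s≤s j≤k)) (partC i (suc j) k eq i≤1+j (s≤s j≤k)))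
      (sym (threeRow-split j k N i)))
  cases : ∀ i j k → i + j + k ≡ suc N → i ≤ j → j ≤ k →
    + (pre (λ i′ → countOf (lattice ∘ (a ∷_)) i′ j k N) i +
      (pre (λ j′ → countOf (lattice ∘ (b ∷_)) i j′ k N) j + pre (λ k′ → countOf (lattice ∘ (c ∷_)) i j k′ N) k))
    ≡ threeRow j k (suc N) i
  cases zero zero (suc k) eq z≤n z≤n = trans (partC zero zero k eq z≤n z≤n)
    (trans (trans (threeRow-zero 0 k N) (ballot-zero k))
      (sym (trans (threeRow-zero 0 (suc k) (suc N)) (ballot-zero (suc k)))))
  cases zero (suc j) (suc k) eq z≤n (s≤s j≤k) = trans (partBC zero j k eq z≤n j≤k)
    (trans (threeRow-zero (suc j) (suc k) N) (sym (threeRow-zero (suc j) (suc k) (suc N))))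
  cases (suc i) (suc j) (suc k) eq (s≤s i≤j) (s≤s j≤k) = trans
    (ℤ.pos-+ (countOf (lattice ∘ (a ∷_)) i (suc j) (suc k) N) _)
    (trans (cong₂ _+ℤ_ (partA i (suc j) (suc k) eq (s≤s i≤j) (s≤s j≤k)) (partBC (suc i) j k eq (s≤s i≤j) j≤k))
      (sym (threeRow-suc (suc j) (suc k) N i)))

-- Words with a prescribed beginning in b and c

infixr 7 _∩_
_∩_ : (Word → Bool) → (Word → Bool) → Word → Bool
(P ∩ Q) w = P w ∧ Q w

countOf-a*c : ∀ P Q → (∀ w → P (b ∷ w) ≡ false) → (∀ w → P (c ∷ w) ≡ Q w) → ∀ i j k N →
  countOf P i j (suc k) (suc N) ≡ pre (λ i′ → countOf (P ∘ (a ∷_)) i′ j (suc k) N) i + countOf Q i j k N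
countOf-a*c P Q Pb Pc i j k N = trans (countOf-suc P i j (suc k) N)
  (cong (_+_ (pre (λ i′ → countOf (P ∘ (a ∷_)) i′ j (suc k) N) i))
    (cong₂ _+_ (noB j) (countOf-cong (P ∘ (c ∷_)) Q i j k N (λ v _ _ _ → Pc (toList v)))))
  where
  noB : ∀ j → pre (λ j′ → countOf (P ∘ (b ∷_)) i j′ (suc k) N) j ≡ 0
  noB zero    = refl
  noB (suc j) = countOf-zero (P ∘ (b ∷_)) i j (suc k) N (λ v _ _ _ → Pb (toList v))

-- Here `p i` is the sum of `q 0` to `q i`, one summand for each number of letters a left behind the
-- first other letter. Summing along a diagonal uses only Pascal's rule and a constant first column,
-- so that binomials and three-row numbers are treated alike. The bound `B` keeps lattice words in
-- range.
hockeyStick : ∀ (f : ℕ → ℕ → ℤ) → (∀ n → f (suc n) 0 ≡ f n 0) → (∀ n i → f (suc n) (suc i) ≡ f n i +ℤ f n (suc i)) →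
  ∀ (p q : ℕ → ℕ) d B → p 0 ≡ q 0 → (∀ i → i < B → p (suc i) ≡ p i + q (suc i)) →
  (∀ i → i ≤ B → + q i ≡ f (i + d) i) → ∀ i → i ≤ B → + p i ≡ f (i + suc d) i
hockeyStick f f₀ f₊ p q d B p₀ p₊ q≡f zero    _   = trans (cong +_ p₀) (trans (q≡f 0 z≤n) (sym (f₀ d)))
hockeyStick f f₀ f₊ p q d B p₀ p₊ q≡f (suc i) i<B = begin
  + p (suc i)                              ≡⟨ cong +_ (p₊ i i<B) ⟩
  + (p i + q (suc i))                      ≡⟨ ℤ.pos-+ (p i) (q (suc i)) ⟩
  + p i +ℤ + q (suc i)                     ≡⟨ cong₂ _+ℤ_ (hockeyStick f f₀ f₊ p q d B p₀ p₊ q≡f i (<⇒≤ i<B))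
    (q≡f (suc i) i<B) ⟩
  f (i + suc d) i +ℤ f (suc (i + d)) (suc i) ≡⟨ cong (λ n → f (i + suc d) i +ℤ f n (suc i)) (+-suc i d) ⟨
  f (i + suc d) i +ℤ f (i + suc d) (suc i) ≡⟨ f₊ (i + suc d) i ⟨
  f (suc i + suc d) (suc i)                ∎
  where open ≡-Reasoning

-- `L` is the number of letters b and c behind the new c. `d` equals `L` for lattice words and is
-- one less for `ballotBC`, where no a may stand last.
hockeyStick-c : ∀ (f : ℕ → ℕ → ℤ) → (∀ n → f (suc n) 0 ≡ f n 0) → (∀ n i → f (suc n) (suc i) ≡ f n i +ℤ f n (suc i)) →
  ∀ P Q j k L d B → (∀ w → # a w < B → # b w ≡ j → P (a ∷ w) ≡ P w) →
  (∀ w → P (b ∷ w) ≡ false) → (∀ w → P (c ∷ w) ≡ Q w) →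
  (∀ i → i ≤ B → + countOf Q i j k (i + L) ≡ f (i + d) i) →
  ∀ i → i ≤ B → + countOf P i j (suc k) (i + suc L) ≡ f (i + suc d) i
hockeyStick-c f f₀ f₊ P Q j k L d B Pa Pb Pc = hockeyStick f f₀ f₊
  (λ i → countOf P i j (suc k) (i + suc L)) (λ i → countOf Q i j k (i + L)) d B
  (countOf-a*c P Q Pb Pc 0 j k L)
  (λ i i<B → trans (countOf-a*c P Q Pb Pc (suc i) j k (i + suc L))
    (cong₂ _+_
      (countOf-cong (P ∘ (a ∷_)) P i j (suc k) (i + suc L) (λ v p q _ → Pa (toList v) (subst (_< B) (sym p) i<B) q))
      (cong (countOf Q (suc i) j k) (+-suc i L))))

-- `j` and `k` count the letters b and c behind the prefix bcc, so s + t is `suc j` and n is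
-- `suc (suc k)`.
module _ (j k M : ℕ) (j+k≡1+M : j + k ≡ suc M) (j≤1+k : j ≤ suc k) where

  private
    f : ℕ → ℕ → ℤ
    f n i = + (n C i) *ℤ ballot (j + k) j

    f₀ : ∀ n → f (suc n) 0 ≡ f n 0
    f₀ n = cong (λ x → + x *ℤ ballot (j + k) j) (trans (nC0≡1 (suc n)) (sym (nC0≡1 n)))

    f₊ : ∀ n i → f (suc n) (suc i) ≡ f n i +ℤ f n (suc i)
    f₊ n i = trans (cong (_*ℤ ballot (j + k) j) (pascal n i))
      (ℤ.*-distribʳ-+ (ballot (j + k) j) (+ (n C i)) (+ (n C suc i)))

    t₀ : ∀ n → threeRow j k (suc n) 0 ≡ threeRow j k n 0
    t₀ n = trans (threeRow-zero j k (suc n)) (sym (threeRow-zero j k n))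

    total : ∀ i → i + j + k ≡ i + suc M
    total i = trans (+-assoc i j k) (cong (_+_ i) j+k≡1+M)

    -- `endsInC (a ∷ w)` and `endsInC w` differ only at the empty `w`, which the pattern `P`
    -- excludes.
    Wa : ∀ (P : Word → Bool) → P [] ≡ false → ∀ w → P w ∧ ballotBC (a ∷ w) ≡ P w ∧ ballotBC w
    Wa P P[] []      = trans (cong (_∧ false) P[]) (sym (cong (_∧ true) P[]))
    Wa P P[] (_ ∷ _) = refl

    Wc : ∀ w → ballotBC (c ∷ w) ≡ ballotBC w
    Wc w = cong (suffixBallot b c w ∧_) (endsInC-c w)

    Fa : ∀ w → # a w < j → # b w ≡ j → lattice (a ∷ w) ≡ lattice w
    Fa w p q = cong (_∧ suffixBallot b c w) (ballotAB-a w refl q p)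

  words-C-ballotBC : ∀ i → + countOf (startsC ∩ ballotBC) i j (suc k) (i + suc (suc M)) ≡ f (i + suc M) i
  words-C-ballotBC i = hockeyStick-c f f₀ f₊ (startsC ∩ ballotBC) ballotBC j k (suc M) M i
    (λ w _ _ → Wa startsC refl w) (λ _ → refl) Wc
    (λ i _ → trans (cong (λ n → + countOf ballotBC i j k n) (+-suc i M))
      (words-ballotBC (i + M) i j k (trans (total i) (+-suc i M)) j≤1+k))
    i ≤-refl

  words-CC-ballotBC : ∀ i → + countOf (startsCC ∩ ballotBC) i j (suc (suc k)) (i + suc (suc (suc M)))
    ≡ f (i + suc (suc M)) i
  words-CC-ballotBC i = hockeyStick-c f f₀ f₊ (startsCC ∩ ballotBC) (startsC ∩ ballotBC) j (suc k) (suc (suc M))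
    (suc M) i
    (λ w _ _ → Wa startsCC refl w) (λ _ → refl) (λ w → cong (startsC w ∧_) (Wc w))
      (λ i _ → words-C-ballotBC i) i ≤-refl

  -- No prefix letter adds a ballot condition: a c never does, and behind the b there are
  -- `suc (suc k)` letters c against `j` letters b. The prefix only gives the letters a three more
  -- places.
  words-BCC-ballotBC : ∀ i → + countOf (startsBCC ∩ ballotBC) i (suc j) (suc (suc k)) (i + suc (suc (suc (suc M))))
    ≡ f (i + suc (suc (suc M))) i
  words-BCC-ballotBC i = hockeyStick f f₀ f₊
    (λ i → countOf (startsBCC ∩ ballotBC) i (suc j) (suc (suc k)) (i + suc (suc (suc (suc M)))))
    (λ i → countOf (startsCC ∩ ballotBC) i j (suc (suc k)) (i + suc (suc (suc M)))) (suc (suc M)) i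
    (recursion 0 (suc (suc (suc M))))
    (λ i _ → trans (recursion (suc i) (i + suc (suc (suc (suc M)))))
      (cong₂ _+_
        (countOf-cong ((startsBCC ∩ ballotBC) ∘ (a ∷_)) (startsBCC ∩ ballotBC) i (suc j) (suc (suc k))
          (i + suc (suc (suc (suc M)))) (λ v _ _ _ → Wa startsBCC refl (toList v)))
        (cong (countOf (startsCC ∩ ballotBC) (suc i) j (suc (suc k))) (+-suc i _))))
    (λ i _ → words-CC-ballotBC i) i ≤-refl
    where
    Wb : ∀ w → # b w ≡ j → # c w ≡ suc (suc k) → startsCC w ∧ ballotBC (b ∷ w) ≡ startsCC w ∧ ballotBC w
    Wb []        _ _ = refl
    Wb w@(_ ∷ _) p q = cong (λ x → startsCC w ∧ (x ∧ endsInC w)) (ballotBC-b w p q (s≤s j≤1+k))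
    recursion : ∀ i N → countOf (startsBCC ∩ ballotBC) i (suc j) (suc (suc k)) (suc N) ≡
      pre (λ i′ → countOf ((startsBCC ∩ ballotBC) ∘ (a ∷_)) i′ (suc j) (suc (suc k)) N) i
      + countOf (startsCC ∩ ballotBC) i j (suc (suc k)) N
    recursion i N = trans (countOf-suc (startsBCC ∩ ballotBC) i (suc j) (suc (suc k)) N)
      (cong (_+_ (pre (λ i′ → countOf ((startsBCC ∩ ballotBC) ∘ (a ∷_)) i′ (suc j) (suc (suc k)) N) i))
        (trans (cong₂ _+_
            (countOf-cong ((startsBCC ∩ ballotBC) ∘ (b ∷_)) (startsCC ∩ ballotBC) i j (suc (suc k)) N
              (λ v _ p q → Wb (toList v) p q))
            (countOf-zero ((startsBCC ∩ ballotBC) ∘ (c ∷_)) i (suc j) (suc k) N (λ v _ _ _ → refl)))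
          (+-identityʳ _)))

  words-C-lattice : ∀ i → i ≤ j → + countOf (startsC ∩ lattice) i j (suc k) (i + suc (suc M))
    ≡ threeRow j k (i + suc (suc M)) i
  words-C-lattice = hockeyStick-c (threeRow j k) t₀ (threeRow-suc j k) (startsC ∩ lattice) lattice j k (suc M)
    (suc M) j
    (λ w p q → cong (startsC w ∧_) (Fa w p q)) (λ _ → refl) (λ _ → refl)
    (λ i i≤j → words-lattice (i + suc M) i j k (total i) (m≤n⇒m≤1+n i≤j) j≤1+k)

  words-CC-lattice : ∀ i → i ≤ j → + countOf (startsCC ∩ lattice) i j (suc (suc k)) (i + suc (suc (suc M)))
    ≡ threeRow j k (i + suc (suc (suc M))) i
  words-CC-lattice = hockeyStick-c (threeRow j k) t₀ (threeRow-suc j k) (startsCC ∩ lattice)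
    (startsC ∩ lattice) j (suc k) (suc (suc M)) (suc (suc M)) j
    (λ w p q → cong (startsCC w ∧_) (Fa w p q)) (λ _ → refl) (λ _ → refl) words-C-lattice

  -- `x` counts the words that start with a, and `y`, for those that start with b, is `u` minus the
  -- lattice words `z`. By Pascal's rule `x + u` is `f N (suc i)`, which is also the first term of
  -- the three-row number for `z`; only its second term survives.
  words-good : ∀ i → suc i ≤ j →
    + countOf (endsInC ∩ good) (suc i) (suc j) (suc (suc k)) (suc (i + suc (suc (suc (suc M)))))
    ≡ ballot (i + suc (suc (suc (suc M)))) i *ℤ ballot (suc j + suc k) (suc j)
  words-good i i<j = begin
    + countOf (endsInC ∩ good) (suc i) (suc j) (suc (suc k)) (suc N)
      ≡⟨ cong +_ (trans (countOf-suc (endsInC ∩ good) (suc i) (suc j) (suc (suc k)) N)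
           (cong₂ _+_ partA (trans (cong₂ _+_ partB partC) (+-identityʳ y)))) ⟩
    + (x + y)
      ≡⟨ ℤ.pos-+ x y ⟩
    + x +ℤ + y
      ≡⟨ arith₁ (+ x) (+ y) (+ z) ⟩
    + x +ℤ (+ z +ℤ + y) - + z
      ≡⟨ cong (λ u → + x +ℤ u - + z) (trans (sym (ℤ.pos-+ z y)) (cong +_ (sym split))) ⟩
    + x +ℤ + u - + z
      ≡⟨ cong₂ _-_ (cong₂ _+ℤ_ (trans (words-BCC-ballotBC i) (cong (λ n → f n i) (+-suc i _))) u≡) z≡ ⟩
    f (suc i + suc (suc M)) i +ℤ f (suc i + suc (suc M)) (suc i) - threeRow j k N (suc i)
      ≡⟨ cong (_- threeRow j k N (suc i)) (f₊ (suc i + suc (suc M)) i) ⟨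
    f (suc (suc i + suc (suc M))) (suc i) - threeRow j k N (suc i)
      ≡⟨ cong (λ n → f n (suc i) - threeRow j k N (suc i)) (cong suc (sym (+-suc i _))) ⟩
    f (suc (i + suc (suc (suc M)))) (suc i) - threeRow j k N (suc i)
      ≡⟨ cong (λ n → f n (suc i) - threeRow j k N (suc i)) (sym (+-suc i _)) ⟩
    f N (suc i) - threeRow j k N (suc i)
      ≡⟨ arith₂ (f N (suc i)) (ballot N i *ℤ ballot (suc j + suc k) (suc j)) ⟩
    ballot N i *ℤ ballot (suc j + suc k) (suc j) ∎
    where
    open ≡-Reasoning
    N x y z u : ℕ
    N = i + suc (suc (suc (suc M)))
    x = countOf (startsBCC ∩ ballotBC) i (suc j) (suc (suc k)) N
    y = count (λ w → (hasCounts (suc i) j (suc (suc k)) w ∧ (startsCC ∩ ballotBC) w) ∧ not (suffixBallot a b w)) N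
    z = countOf (startsCC ∩ lattice) (suc i) j (suc (suc k)) N
    u = countOf (startsCC ∩ ballotBC) (suc i) j (suc (suc k)) N
    N≡ : N ≡ suc i + suc (suc (suc M))
    N≡ = +-suc i _
    u≡ : + u ≡ f (suc i + suc (suc M)) (suc i)
    u≡ = trans (cong (λ n → + countOf (startsCC ∩ ballotBC) (suc i) j (suc (suc k)) n) N≡) (words-CC-ballotBC (suc i))
    z≡ : + z ≡ threeRow j k N (suc i)
    z≡ = subst (λ n → + countOf (startsCC ∩ lattice) (suc i) j (suc (suc k)) n ≡ threeRow j k n (suc i)) (sym N≡)
      (words-CC-lattice (suc i) i<j)
    split : u ≡ z + y
    split = trans (count-split (λ w → hasCounts (suc i) j (suc (suc k)) w ∧ (startsCC ∩ ballotBC) w)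
      (suffixBallot a b) N)
      (cong (_+ y) (count-cong (λ w → (hasCounts (suc i) j (suc (suc k)) w ∧
        (startsCC ∩ ballotBC) w) ∧ suffixBallot a b w)
          (λ w → hasCounts (suc i) j (suc (suc k)) w ∧ (startsCC ∩ lattice) w) N
        (λ v → pointwise (hasCounts (suc i) j (suc (suc k)) (toList v)) (startsCC (toList v)) _ _ _
          (lattice⇒endsInC (toList v)))))
      where
      pointwise : ∀ t p q r e → (q ≡ true → r ≡ true → e ≡ true) → (t ∧ (p ∧ (r ∧ e))) ∧ q ≡ t ∧ (p ∧ (q ∧ r))
      pointwise false _     _     _     _ _ = refl
      pointwise true  false _     _     _ _ = refl
      pointwise true  true  false r     e _ = ∧-zeroʳ (r ∧ e)
      pointwise true  true  true  false _ _ = refl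
      pointwise true  true  true  true  e h = cong (_∧ true) (h refl refl)
    partA : countOf ((endsInC ∩ good) ∘ (a ∷_)) i (suc j) (suc (suc k)) N ≡ x
    partA = countOf-cong ((endsInC ∩ good) ∘ (a ∷_)) (startsBCC ∩ ballotBC) i (suc j) (suc (suc k)) N
      (λ v _ _ _ → pointwise (toList v))
      where
      shuffle : ∀ p q r → p ∧ (q ∧ r) ≡ q ∧ (r ∧ p)
      shuffle p q r = trans (∧-comm p (q ∧ r)) (∧-assoc q r p)
      pointwise : ∀ w → endsInC (a ∷ w) ∧ (startsBCC w ∧ suffixBallot b c w)
        ≡ startsBCC w ∧ (suffixBallot b c w ∧ endsInC w)
      pointwise []        = refl
      pointwise w@(_ ∷ _) = shuffle (endsInC w) (startsBCC w) (suffixBallot b c w)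
    partB : countOf ((endsInC ∩ good) ∘ (b ∷_)) (suc i) j (suc (suc k)) N ≡ y
    partB = trans
      (countOf-cong ((endsInC ∩ good) ∘ (b ∷_)) (λ w → (startsCC ∩ ballotBC) w ∧ not (suffixBallot a b w))
        (suc i) j (suc (suc k)) N (λ v _ p q → pointwise (toList v) p q))
      (count-cong (λ w → hasCounts (suc i) j (suc (suc k)) w ∧
        ((startsCC ∩ ballotBC) w ∧ not (suffixBallot a b w)))
          (λ w → (hasCounts (suc i) j (suc (suc k)) w ∧ (startsCC ∩ ballotBC) w) ∧ not (suffixBallot a b w)) N
        (λ v → sym (∧-assoc (hasCounts (suc i) j (suc (suc k)) (toList v)) _ _)))
      where
      shuffle : ∀ p q r s → p ∧ ((q ∧ r) ∧ s) ≡ (q ∧ (r ∧ p)) ∧ s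
      shuffle p q r s = trans (sym (∧-assoc p (q ∧ r) s)) (cong (_∧ s) (trans (∧-comm p (q ∧ r)) (∧-assoc q r p)))
      pointwise : ∀ w → # b w ≡ j → # c w ≡ suc (suc k) →
        endsInC (b ∷ w) ∧ ((startsCC w ∧ suffixBallot b c (b ∷ w)) ∧ not (suffixBallot a b w)) ≡
          (startsCC w ∧ (suffixBallot b c w ∧ endsInC w)) ∧ not (suffixBallot a b w)
      pointwise []        _ _ = refl
      pointwise w@(_ ∷ _) p q = trans
        (cong (λ x → endsInC w ∧ ((startsCC w ∧ x) ∧ not (suffixBallot a b w))) (ballotBC-b w p q (s≤s j≤1+k)))
        (shuffle (endsInC w) (startsCC w) (suffixBallot b c w) (not (suffixBallot a b w)))
    partC : countOf ((endsInC ∩ good) ∘ (c ∷_)) (suc i) (suc j) (suc k) N ≡ 0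
    partC = countOf-zero ((endsInC ∩ good) ∘ (c ∷_)) (suc i) (suc j) (suc k) N
      (λ v _ _ _ → ∧-zeroʳ (endsInC (c ∷ toList v)))
    arith₁ : ∀ x y z → x +ℤ y ≡ x +ℤ (z +ℤ y) - z
    arith₁ = solve-∀
    arith₂ : ∀ p q → p - (p - q) ≡ q
    arith₂ = solve-∀

-- Greedy bullying

Sorted : List ℕ → Set
Sorted = AllPairs _<_

cnt : (ℕ → Bool) → List ℕ → ℕ
cnt p []       = 0
cnt p (y ∷ ys) = indicator (p y) + cnt p ys

cnt-↭ : ∀ p {xs ys} → xs ↭ ys → cnt p xs ≡ cnt p ys
cnt-↭ p refl           = refl
cnt-↭ p (prep x e)     = cong (_+_ (indicator (p x))) (cnt-↭ p e)
cnt-↭ p (swap {xs} {ys} x y e) = begin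
  indicator (p x) + (indicator (p y) + cnt p xs) ≡⟨ +-assoc (indicator (p x)) _ _ ⟨
  indicator (p x) + indicator (p y) + cnt p xs   ≡⟨ cong₂ _+_ (+-comm (indicator (p x)) (indicator (p y)))
    (cnt-↭ p e) ⟩
  indicator (p y) + indicator (p x) + cnt p ys   ≡⟨ +-assoc (indicator (p y)) _ _ ⟩
  indicator (p y) + (indicator (p x) + cnt p ys) ∎
  where open ≡-Reasoning
cnt-↭ p (↭-compose e₁ e₂)  = trans (cnt-↭ p e₁) (cnt-↭ p e₂)

indicator-mono : ∀ {p q} → (p ≡ true → q ≡ true) → indicator p ≤ indicator q
indicator-mono {false}         h = z≤n
indicator-mono {true}  {true}  h = ≤-refl
indicator-mono {true}  {false} h with h refl
... | ()

cnt-mono : ∀ p q xs → (∀ {x} → x ∈ xs → p x ≡ true → q x ≡ true) → cnt p xs ≤ cnt q xs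
cnt-mono p q []       h = z≤n
cnt-mono p q (x ∷ xs) h = +-mono-≤ (indicator-mono (h (here refl))) (cnt-mono p q xs (h ∘ there))

≤⇒≤ᵇ-true : ∀ {m n} → m ≤ n → (m ≤ᵇ n) ≡ true
≤⇒≤ᵇ-true {m} {n} m≤n with m ≤ᵇ n | ≤⇒≤ᵇ m≤n
... | true | _ = refl

≤ᵇ-true⇒≤ : ∀ {m n} → (m ≤ᵇ n) ≡ true → m ≤ n
≤ᵇ-true⇒≤ {m} {n} e = ≤ᵇ⇒≤ m n (subst T (sym e) tt)

-- Hall's condition for matching every entry of xs with a larger entry of L.
Dominated : List ℕ → List ℕ → Set
Dominated xs L = ∀ z → cnt (z ≤ᵇ_) xs ≤ cnt (z <ᵇ_) L

data Outcome (x : ℕ) (L : List ℕ) (y : ℕ) : Bool → Set where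
  above : x < y → (∀ {u} → u ∈ L → x < u → y ≤ u) → Outcome x L y false
  wraps : (∀ {u} → u ∈ L → u ≤ x) → (∀ {u} → u ∈ L → y ≤ u) → Outcome x L y true

-- `fresh` is a field of its own because `perm` does not exclude a second copy of `y`.
record Step (x : ℕ) (L : List ℕ) (y : ℕ) (w : Bool) (L′ : List ℕ) : Set where
  field
    equation : bullyStep x L ≡ just (y , w , L′)
    perm     : L ↭ y ∷ L′
    fresh    : y ∉ L′
    sorted   : Sorted L′
    outcome  : Outcome x L y w

  ∈-rest : ∀ {u} → u ∈ L′ → u ∈ L
  ∈-rest u∈ = ∈-resp-↭ (↭-sym perm) (there u∈)

  target∈ : y ∈ L
  target∈ = ∈-resp-↭ (↭-sym perm) (here refl)

  ∈-still : ∀ {u} → u ∈ L → u ≢ y → u ∈ L′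
  ∈-still u∈ u≢y with ∈-resp-↭ perm u∈
  ... | here u≡y  = contradiction u≡y u≢y
  ... | there u∈′ = u∈′

open Step

∉-sorted : ∀ {y ys} → All (y <_) ys → y ∉ ys
∉-sorted y<ys y∈ys = <-irrefl refl (All.lookup y<ys y∈ys)

minAbove-just : ∀ x L {y} → Sorted L → minAbove x L ≡ just y → x < y × y ∈ L × (∀ {u} → u ∈ L → x < u → y ≤ u)
minAbove-just x (z ∷ L) (z<L ∷ sL) e with x <ᵇ z in x<ᵇz
minAbove-just x (z ∷ L) (z<L ∷ sL) refl | true = <ᵇ-true⇒< x<ᵇz , here refl ,
  λ { (here refl) _ → ≤-refl ; (there u∈) _ → <⇒≤ (All.lookup z<L u∈) }
... | false with minAbove-just x L sL e
...   | x<y , y∈L , least = x<y , there y∈L ,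
  λ { (here refl) x<z → contradiction (trans (sym (<⇒<ᵇ-true x<z)) x<ᵇz) λ () ; (there u∈) → least u∈ }

minAbove-nothing : ∀ x L → minAbove x L ≡ nothing → ∀ {u} → u ∈ L → u ≤ x
minAbove-nothing x (z ∷ L) e u∈ with x <ᵇ z in x<ᵇz
minAbove-nothing x (z ∷ L) () u∈ | true
minAbove-nothing x (z ∷ L) e (here refl) | false = ≮⇒≥ (λ x<z → contradiction (trans (sym (<⇒<ᵇ-true x<z)) x<ᵇz) λ ())
minAbove-nothing x (z ∷ L) e (there u∈) | false = minAbove-nothing x L e u∈

≡ᵇ-refl : ∀ n → (n ≡ᵇ n) ≡ true
≡ᵇ-refl zero    = refl
≡ᵇ-refl (suc n) = ≡ᵇ-refl n

≡ᵇ-false⇒≢ : ∀ {m n} → (m ≡ᵇ n) ≡ false → m ≢ n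
≡ᵇ-false⇒≢ {m} e refl = contradiction (trans (sym e) (≡ᵇ-refl m)) λ ()

remove-↭ : ∀ {y} L → y ∈ L → L ↭ y ∷ remove y L
remove-↭ {y} (z ∷ L) y∈ with y ≡ᵇ z in e
... | true rewrite ≡ᵇ-true⇒≡ y z e = refl
remove-↭ {y} (z ∷ L) (here y≡z) | false = contradiction y≡z (≡ᵇ-false⇒≢ e)
remove-↭ {y} (z ∷ L) (there y∈) | false = ↭-compose (prep z (remove-↭ L y∈)) (swap z y refl)

remove-All : ∀ {P : ℕ → Set} y {L} → All P L → All P (remove y L)
remove-All y []                = []
remove-All y (_∷_ {x = z} p ps) with y ≡ᵇ z
... | true  = ps
... | false = p ∷ remove-All y ps

remove-sorted : ∀ y {L} → Sorted L → Sorted (remove y L)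
remove-sorted y []                  = []
remove-sorted y (_∷_ {x = z} p ps) with y ≡ᵇ z
... | true  = ps
... | false = remove-All y p ∷ remove-sorted y ps

remove-∉ : ∀ y {L} → Sorted L → y ∉ remove y L
remove-∉ y (_∷_ {x = z} p ps) y∈ with y ≡ᵇ z in e
... | true rewrite ≡ᵇ-true⇒≡ y z e = ∉-sorted p y∈
remove-∉ y (_∷_ {x = z} p ps) (here y≡z) | false = ≡ᵇ-false⇒≢ e y≡z
remove-∉ y (_∷_ {x = z} p ps) (there y∈) | false = remove-∉ y ps y∈

bullyStep-just : ∀ x L {y} → minAbove x L ≡ just y → bullyStep x L ≡ just (y , false , remove y L)
bullyStep-just x L e rewrite e = refl

bullyStep-nothing : ∀ x y L → minAbove x (y ∷ L) ≡ nothing → bullyStep x (y ∷ L) ≡ just (y , true , L)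
bullyStep-nothing x y L e rewrite e = refl

step : ∀ x L → Sorted L → 1 ≤ length L → ∃ λ y → ∃ λ w → ∃ λ L′ → Step x L y w L′
step x L@(z ∷ L₁) sL@(z<L₁ ∷ sL₁) _ with minAbove x L in e
... | just y with minAbove-just x L sL e
...   | x<y , y∈L , least = y , false , remove y L , record
  { equation = bullyStep-just x L e
  ; perm     = remove-↭ L y∈L
  ; fresh    = remove-∉ y sL
  ; sorted   = remove-sorted y sL
  ; outcome  = above x<y least
  }
step x L@(z ∷ L₁) sL@(z<L₁ ∷ sL₁) _ | nothing = z , true , L₁ , record
  { equation = bullyStep-nothing x z L₁ e
  ; perm     = refl
  ; fresh    = ∉-sorted z<L₁
  ; sorted   = sL₁
  ; outcome  = wraps (minAbove-nothing x L e) λ { (here refl) → ≤-refl ; (there u∈) → <⇒≤ (All.lookup z<L₁ u∈) }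
  }

-- Run xs L ys w L′: the entries xs bully, in this order, the entries ys of a row with available
-- entries L, leaving L′ available; w says whether some bullying is a wrapping.
data Run : List ℕ → List ℕ → List ℕ → Bool → List ℕ → Set where
  []  : ∀ {L} → Run [] L [] false L
  _∷_ : ∀ {x xs y ys w w′ L L₁ L₂} → Step x L y w L₁ → Run xs L₁ ys w′ L₂ → Run (x ∷ xs) L (y ∷ ys) (w ∨ w′) L₂

run-perm : ∀ {xs L ys w L′} → Run xs L ys w L′ → L ↭ ys ++ L′
run-perm []      = refl
run-perm (s ∷ r) = ↭-compose (perm s) (prep _ (run-perm r))

run-sorted : ∀ {xs L ys w L′} → Sorted L → Run xs L ys w L′ → Sorted L′
run-sorted sL []      = sL
run-sorted sL (s ∷ r) = run-sorted (sorted s) r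

run-∈-rest : ∀ {xs L ys w L′ u} → Run xs L ys w L′ → u ∈ L′ → u ∈ L
run-∈-rest {ys = ys} r u∈ = ∈-resp-↭ (↭-sym (run-perm r)) (∈-++⁺ʳ ys u∈)

run-∈-targets : ∀ {xs L ys w L′ u} → Run xs L ys w L′ → u ∈ ys → u ∈ L
run-∈-targets r u∈ = ∈-resp-↭ (↭-sym (run-perm r)) (∈-++⁺ˡ u∈)

run-∈-still : ∀ {xs L ys w L′ u} → Run xs L ys w L′ → u ∈ L → u ∉ ys → u ∈ L′
run-∈-still {ys = ys} r u∈ u∉ys with ∈-++⁻ ys (∈-resp-↭ (run-perm r) u∈)
... | inj₁ u∈ys = contradiction u∈ys u∉ys
... | inj₂ u∈L′ = u∈L′

run-fresh : ∀ {xs L ys w L′ u} → Run xs L ys w L′ → u ∈ ys → u ∉ L′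
run-fresh (s ∷ r) (here refl) u∈L′ = fresh s (run-∈-rest r u∈L′)
run-fresh (s ∷ r) (there u∈)  u∈L′ = run-fresh r u∈ u∈L′

run-unique : ∀ {xs L ys w L′} → Run xs L ys w L′ → AllPairs _≢_ ys
run-unique []      = []
run-unique (s ∷ r) = All.tabulate (λ { u∈ refl → fresh s (run-∈-targets r u∈) }) ∷ run-unique r

↭-length-suc : ∀ {x : ℕ} {xs L n} → L ↭ x ∷ xs → suc n ≤ length L → n ≤ length xs
↭-length-suc e le = ≤-pred (subst (_ ≤_) (↭-length e) le)

run : ∀ xs L → Sorted L → length xs ≤ length L → ∃ λ ys → ∃ λ w → ∃ λ L′ → Run xs L ys w L′
run []       L sL _  = [] , false , L , []
run (x ∷ xs) L sL le with step x L sL (≤-trans (s≤s z≤n) le)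
... | y , w , L₁ , s with run xs L₁ (sorted s) (↭-length-suc (perm s) le)
...   | ys , w′ , L₂ , r = y ∷ ys , w ∨ w′ , L₂ , s ∷ r

run-length : ∀ {xs L ys w L′} → Run xs L ys w L′ → length xs ≡ length ys
run-length []      = refl
run-length (s ∷ r) = cong suc (run-length r)

run-length-rest : ∀ {xs L ys w L′} → Run xs L ys w L′ → length L ≡ length xs + length L′
run-length-rest {ys = ys} {L′ = L′} r = trans (↭-length (run-perm r))
  (trans (length-++ ys) (cong (_+ length L′) (sym (run-length r))))

run-++ : ∀ {xs xs′ L ys ys′ w w′ L₁ L₂} → Run xs L ys w L₁ → Run xs′ L₁ ys′ w′ L₂ →
  Run (xs ++ xs′) L (ys ++ ys′) (w ∨ w′) L₂
run-++ []                                  r′ = r′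
run-++ {w′ = w″} (_∷_ {w = w} {w′} s r) r′ = subst (λ v → Run _ _ _ v _) (sym (∨-assoc w w′ w″)) (s ∷ run-++ r r′)

run-dominated : ∀ {xs L ys L′} w → w ≡ false → Run xs L ys w L′ → Dominated xs L
run-dominated _ e []      z = z≤n
run-dominated _ e (_∷_ {x} {y = y} {w = w} {w′} s r) z with w | outcome s | e
... | true  | _             | ()
... | false | above x<y _ | e′ = ≤-trans
  (+-mono-≤ (indicator-mono {z ≤ᵇ x} {z <ᵇ y} (λ z≤x → <⇒<ᵇ-true (≤-<-trans (≤ᵇ-true⇒≤ z≤x) x<y)))
    (run-dominated w′ e′ r z))
  (≤-reflexive (sym (cnt-↭ (z <ᵇ_) (perm s))))

-- The critical thresholds are `x < z < y`: there the count of `L` drops while that of the sources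
-- does not. As no available entry lies strictly between `x` and `y`, the condition at `z` follows
-- from the one at `x`, where both counts drop.
dominated-step : ∀ {x xs L y L₁} → Dominated (x ∷ xs) L → L ↭ y ∷ L₁ → x < y → (∀ {u} → u ∈ L → x < u → y ≤ u) →
  Dominated xs L₁
dominated-step {x} {xs} {L} {y} {L₁} D L↭ x<y least z with z ≤? x
... | yes z≤x = ≤-pred (subst₂ _≤_
  (cong (λ p → indicator p + cnt (z ≤ᵇ_) xs) (≤⇒≤ᵇ-true z≤x))
  (cong (λ p → indicator p + cnt (z <ᵇ_) L₁) (<⇒<ᵇ-true (≤-<-trans z≤x x<y)))
  (D′ z))
  where
  D′ : ∀ z → indicator (z ≤ᵇ x) + cnt (z ≤ᵇ_) xs ≤ indicator (z <ᵇ y) + cnt (z <ᵇ_) L₁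
  D′ z = subst (_ ≤_) (cnt-↭ (z <ᵇ_) L↭) (D z)
... | no z≰x with z <? y
...   | no z≮y = ≤-trans (m≤n+m (cnt (z ≤ᵇ_) xs) (indicator (z ≤ᵇ x)))
  (≤-trans {j = cnt (z <ᵇ_) L} (D z) (≤-reflexive (trans (cnt-↭ (z <ᵇ_) L↭)
    (cong (λ p → indicator p + cnt (z <ᵇ_) L₁) (¬-not {y = true} (z≮y ∘ <ᵇ-true⇒<))))))
...   | yes z<y = begin
  cnt (z ≤ᵇ_) xs ≤⟨ cnt-mono (z ≤ᵇ_) (x ≤ᵇ_) xs (λ _ z≤u → ≤⇒≤ᵇ-true (≤-trans (<⇒≤ (≰⇒> z≰x)) (≤ᵇ-true⇒≤ z≤u))) ⟩
  cnt (x ≤ᵇ_) xs ≤⟨ ≤-pred (subst₂ _≤_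
      (cong (λ p → indicator p + cnt (x ≤ᵇ_) xs) (≤⇒≤ᵇ-true (≤-refl {x})))
      (trans (cnt-↭ (x <ᵇ_) L↭) (cong (λ p → indicator p + cnt (x <ᵇ_) L₁) (<⇒<ᵇ-true x<y)))
      (D x)) ⟩
  cnt (x <ᵇ_) L₁ ≤⟨ cnt-mono (x <ᵇ_) (z <ᵇ_) L₁ (λ u∈ x<u →
      <⇒<ᵇ-true (<-≤-trans z<y (least (∈-resp-↭ (↭-sym L↭) (there u∈)) (<ᵇ-true⇒< x<u)))) ⟩
  cnt (z <ᵇ_) L₁ ∎
  where open ≤-Reasoning

-- A wrapping from `x` means that nothing above `x` is available, but the condition at the threshold
-- `x` counts `x` itself. Together with `run-dominated` this makes wrapping independent of the order
-- of `xs`, as `Dominated` is invariant under permutations.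
dominated-run : ∀ {xs L ys w L′} → Run xs L ys w L′ → Dominated xs L → w ≡ false
dominated-run []      D = refl
dominated-run (_∷_ {x} {xs} {w = w} {L = L} s r) D with w | outcome s
... | false | above x<y least = dominated-run r (dominated-step {xs = xs} D (perm s) x<y least)
... | true  | wraps ≤x _ = contradiction contra λ ()
  where
  none : ∀ M → (∀ {u} → u ∈ M → u ≤ x) → cnt (x <ᵇ_) M ≡ 0
  none []      h = refl
  none (u ∷ M) h rewrite ¬-not {x <ᵇ u} {true} (λ x<u → <⇒≱ (<ᵇ-true⇒< x<u) (h (here refl))) = none M (h ∘ there)
  contra : 1 ≤ 0
  contra = ≤-trans (≤-trans (≤-reflexive (sym (cong indicator (≤⇒≤ᵇ-true (≤-refl {x}))))) (m≤m+n _ (cnt (x ≤ᵇ_) xs)))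
    (≤-trans (D x) (≤-reflexive (none L ≤x)))

run-targets> : ∀ {xs L ys w L′ m} → Run xs L ys w L′ → w ≡ false → (∀ {x} → x ∈ xs → m ≤ x) → ∀ {y} → y ∈ ys → m < y
run-targets> (_∷_ {w = w} s r) e h y∈ with w | outcome s
run-targets> (s ∷ r) e h (here refl) | false | above x<y _ = ≤-<-trans (h (here refl)) x<y
run-targets> (s ∷ r) e h (there y∈)  | false | above x<y _ = run-targets> r e (h ∘ there) y∈

-- An entry below `m` would find `m` as the smallest available entry above it and take it.
run-sources≥ : ∀ {xs L ys w L′ m} → Run xs L ys w L′ → w ≡ false → m ∈ L′ → (∀ {u} → u ∈ L → m ≤ u) →
  ∀ {x} → x ∈ xs → m ≤ x
run-sources≥ {m = m} (_∷_ {x} {w = w} s r) e m∈ h x∈ with w | outcome s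
run-sources≥ {m = m} (_∷_ {x} s r) e m∈ h (here refl) | false | above x<y least with m ≤? x
... | yes m≤x = m≤x
... | no  m≰x = contradiction (subst (_∈ _) m≡y (run-∈-rest r m∈)) (fresh s)
  where
  m≡y = ≤-antisym (h (target∈ s)) (least (∈-rest s (run-∈-rest r m∈)) (≰⇒> m≰x))
run-sources≥ (s ∷ r) e m∈ h (there x∈) | false | above x<y least = run-sources≥ r e m∈ (h ∘ ∈-rest s) x∈

-- The first source below `c₂` must take `c₁`, since otherwise it would take `c₂`. From then on `c₂`
-- is the least available entry and is never taken, so `run-sources≥` applies to all later sources.
run-source-of-first : ∀ {xs L ys w L′ c₁ c₂} → Run xs L ys w L′ → w ≡ false → c₁ ∈ ys → c₂ ∈ L′ → c₁ < c₂ →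
  (∀ {u} → u ∈ L → u ≡ c₁ ⊎ c₂ ≤ u) →
  ∃ λ x → x ∈ xs × x < c₁ × (∀ {x′} → x′ ∈ xs → x′ ≡ x ⊎ c₂ ≤ x′)
run-source-of-first {c₁ = c₁} {c₂} (_∷_ {x} {w = w} s r) e c₁∈ c₂∈ c₁<c₂ h with w | outcome s
... | false | above x<y least with c₂ ≤? x
...   | no c₂≰x with h (target∈ s)
...     | inj₂ c₂≤y = contradiction
  (subst (_∈ _) (≤-antisym c₂≤y (least (∈-rest s (run-∈-rest r c₂∈)) (≰⇒> c₂≰x))) (run-∈-rest r c₂∈)) (fresh s)
...     | inj₁ refl = x , here refl , x<y ,
  λ { (here refl) → inj₁ refl ; (there x′∈) → inj₂ (run-sources≥ r e c₂∈ later x′∈) }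
  where
  later : ∀ {u} → u ∈ _ → c₂ ≤ u
  later u∈ with h (∈-rest s u∈)
  ... | inj₁ refl = contradiction u∈ (fresh s)
  ... | inj₂ le   = le
run-source-of-first {c₁ = c₁} {c₂} (_∷_ {x} {w = w} s r) e
  (here refl) c₂∈ c₁<c₂ h | false | above x<y least | yes c₂≤x =
  contradiction (<-trans c₁<c₂ (≤-<-trans c₂≤x x<y)) (<-irrefl refl)
run-source-of-first {c₁ = c₁} {c₂} (_∷_ {x} {w = w} s r) e
  (there c₁∈) c₂∈ c₁<c₂ h | false | above x<y least | yes c₂≤x
  with run-source-of-first r e c₁∈ c₂∈ c₁<c₂ (h ∘ ∈-rest s)
... | x₀ , x₀∈ , x₀<c₁ , others = x₀ , there x₀∈ , x₀<c₁ , λ { (here refl) → inj₂ c₂≤x ; (there x′∈) → others x′∈ }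

-- Sources from `c₂` on only reach beyond `c₂`, so `c₁` is still available when `b₁` bullies.
-- Distinctness of `xs` ensures that `b₁` bullies only once.
run-hits-first : ∀ {xs L ys w L′ b₁ c₁ c₂} → Run xs L ys w L′ → w ≡ false → AllPairs _≢_ xs → b₁ ∈ xs →
  (∀ {x} → x ∈ xs → x ≡ b₁ ⊎ c₂ ≤ x) → b₁ < c₁ → c₁ < c₂ → c₁ ∈ L → (∀ {u} → u ∈ L → c₁ ≤ u) → c₁ ∈ ys × c₂ ∉ ys
run-hits-first {b₁ = b₁} {c₁} {c₂} (_∷_ {x} {w = w} s r) e
  (x≢ ∷ u) b₁∈ h b₁<c₁ c₁<c₂ c₁∈ least′ with w | outcome s | h (here refl)
... | false | above x<y least | inj₁ refl = here c₁≡y ,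
  λ { (here c₂≡y) → <-irrefl (trans c₁≡y (sym c₂≡y)) c₁<c₂ ; (there c₂∈) → <-irrefl refl
    (run-targets> r e later c₂∈) }
  where
  c₁≡y = ≤-antisym (least′ (target∈ s)) (least c₁∈ b₁<c₁)
  later : ∀ {x′} → x′ ∈ _ → c₂ ≤ x′
  later x′∈ with h (there x′∈)
  ... | inj₁ refl = contradiction refl (All.lookup x≢ x′∈)
  ... | inj₂ le   = le
run-hits-first {b₁ = b₁} {c₁} {c₂} (_∷_ {x} s r) e (x≢ ∷ u)
  (here refl) h b₁<c₁ c₁<c₂ c₁∈ least′ | false | above x<y least | inj₂ c₂≤x =
  contradiction (<-trans b₁<c₁ c₁<c₂) (≤⇒≯ c₂≤x)
run-hits-first {b₁ = b₁} {c₁} {c₂} (_∷_ {x} s r) e (x≢ ∷ u)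
  (there b₁∈) h b₁<c₁ c₁<c₂ c₁∈ least′ | false | above x<y least | inj₂ c₂≤x
  with run-hits-first r e u b₁∈ (h ∘ there) b₁<c₁ c₁<c₂
    (∈-still s c₁∈ (λ { refl → <-irrefl refl (<-trans c₁<c₂ (≤-<-trans c₂≤x x<y)) })) (least′ ∘ ∈-rest s)
... | c₁∈ys , c₂∉ys = there c₁∈ys , λ { (here refl) → <-irrefl refl (≤-<-trans c₂≤x x<y) ; (there c₂∈) → c₂∉ys c₂∈ }

-- The first wrapping takes the least available entry, and this is `m` unless an earlier step took
-- it.
run-wraps⇒least : ∀ {xs L ys w L′ m} → Run xs L ys w L′ → w ≡ true → m ∈ L → (∀ {u} → u ∈ L → m ≤ u) → m ∈ ys
run-wraps⇒least {m = m} (_∷_ {y = y} {w = w} s r) e m∈ h with w | outcome s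
... | true  | wraps _ least = here (≤-antisym (h (target∈ s)) (least m∈))
... | false | above _ _ with m ≟ y
...   | yes m≡y = here m≡y
...   | no  m≢y = there (run-wraps⇒least r e (∈-still s m∈ m≢y) (h ∘ ∈-rest s))

run-starts-below⇒least : ∀ {x xs L ys w L′ m} → Run (x ∷ xs) L ys w L′ → x < m → m ∈ L →
  (∀ {u} → u ∈ L → m ≤ u) → m ∈ ys
run-starts-below⇒least (_∷_ {w = w} s r) x<m m∈ h with w | outcome s
... | true  | wraps ≤x _    = contradiction (≤x m∈) (<⇒≱ x<m)
... | false | above _ least = here (≤-antisym (h (target∈ s)) (least m∈ x<m))

-- Labels of the first two entries of row 3

∨-false⇒ : ∀ w w′ → w ∨ w′ ≡ false → w ≡ false × w′ ≡ false
∨-false⇒ false false _ = refl , refl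

head≤ : ∀ {x xs u} → Sorted (x ∷ xs) → u ∈ x ∷ xs → x ≤ u
head≤ _          (here refl) = ≤-refl
head≤ (x<xs ∷ _) (there u∈)  = <⇒≤ (All.lookup x<xs u∈)

-- This is what no wrapping into row 3, ω₁ = 1 and ω₂ = 3 amount to. The bullying order survives
-- only in `bs`, the entries of row 2 that are hit from row 1.
Shape : ℕ → List ℕ → ℕ → ℕ → List ℕ → List ℕ → Set
Shape b₁ Bs c₁ c₂ Cs bs = Dominated (b₁ ∷ Bs) (c₁ ∷ c₂ ∷ Cs) × b₁ < c₁ × (∀ {x} → x ∈ Bs → c₂ ≤ x) × b₁ ∈ bs

module _ {b₁ c₁ c₂ : ℕ} {Bs Cs r₁ bs A₂ cs₁ A₃ cs₂ A₃′ : List ℕ} {w w₁ w₂ : Bool}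
  (sortedB : Sorted (b₁ ∷ Bs)) (sortedC : Sorted (c₁ ∷ c₂ ∷ Cs))
  (run₁₂ : Run r₁ (b₁ ∷ Bs) bs w A₂) (run₂₃ : Run bs (c₁ ∷ c₂ ∷ Cs) cs₁ w₁ A₃) (run₂₃′ : Run A₂ A₃ cs₂ w₂ A₃′) where

  private
    c₁<c₂ : c₁ < c₂
    c₁<c₂ = All.head (AllPairs.head sortedC)

    c₁-or-≥c₂ : ∀ {u} → u ∈ c₁ ∷ c₂ ∷ Cs → u ≡ c₁ ⊎ c₂ ≤ u
    c₁-or-≥c₂ (here u≡c₁) = inj₁ u≡c₁
    c₁-or-≥c₂ (there u∈)  = inj₂ (head≤ (AllPairs.tail sortedC) u∈)

    -- Paths from row 1 and from row 2 join into one run whose sources are a permutation of row 2,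
    -- so that Hall's condition can be applied to the entire row.
    whole : Run (bs ++ A₂) (c₁ ∷ c₂ ∷ Cs) (cs₁ ++ cs₂) (w₁ ∨ w₂) A₃′
    whole = run-++ run₂₃ run₂₃′

  label13⇒shape : w₁ ∨ w₂ ≡ false → c₁ ∈ cs₁ → c₂ ∉ cs₁ → c₂ ∉ cs₂ →
    Shape b₁ Bs c₁ c₂ Cs bs
  label13⇒shape e c₁∈ c₂∉₁ c₂∉₂ with ∨-false⇒ w₁ w₂ e
  ... | e₁ , e₂ with run-source-of-first run₂₃ e₁ c₁∈ (run-∈-still run₂₃ (there (here refl)) c₂∉₁) c₁<c₂ c₁-or-≥c₂
  ...   | x , x∈ , x<c₁ , others =
    (λ z → subst (_≤ cnt (z <ᵇ_) (c₁ ∷ c₂ ∷ Cs)) (sym (cnt-↭ (z ≤ᵇ_) (run-perm run₁₂))) (run-dominated _ e whole z)) ,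
    subst (_< c₁) (sym b₁≡x) x<c₁ , B≥c₂ , subst (_∈ bs) (sym b₁≡x) x∈
    where
    remaining≥c₂ : ∀ {u} → u ∈ A₃ → c₂ ≤ u
    remaining≥c₂ u∈ with c₁-or-≥c₂ (run-∈-rest run₂₃ u∈)
    ... | inj₁ refl = contradiction u∈ (run-fresh run₂₃ c₁∈)
    ... | inj₂ le   = le
    c₂∈A₃′ : c₂ ∈ A₃′
    c₂∈A₃′ = run-∈-still run₂₃′ (run-∈-still run₂₃ (there (here refl)) c₂∉₁) c₂∉₂
    x-or-≥c₂ : ∀ {x′} → x′ ∈ b₁ ∷ Bs → x′ ≡ x ⊎ c₂ ≤ x′
    x-or-≥c₂ x′∈ with ∈-++⁻ bs (∈-resp-↭ (run-perm run₁₂) x′∈)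
    ... | inj₁ ∈bs = others ∈bs
    ... | inj₂ ∈A₂ = inj₂ (run-sources≥ run₂₃′ e₂ c₂∈A₃′ remaining≥c₂ ∈A₂)
    b₁≡x : b₁ ≡ x
    b₁≡x with x-or-≥c₂ (here refl)
    ... | inj₁ b₁≡x = b₁≡x
    ... | inj₂ c₂≤b₁ = contradiction (<-trans x<c₁ c₁<c₂)
      (≤⇒≯ (≤-trans c₂≤b₁ (head≤ sortedB (run-∈-targets run₁₂ x∈))))
    B≥c₂ : ∀ {x′} → x′ ∈ Bs → c₂ ≤ x′
    B≥c₂ x′∈ with x-or-≥c₂ (there x′∈)
    ... | inj₁ refl = contradiction (All.lookup (AllPairs.head sortedB) x′∈) (<-irrefl b₁≡x)
    ... | inj₂ le   = le

  shape⇒label13 : Dominated (b₁ ∷ Bs) (c₁ ∷ c₂ ∷ Cs) → b₁ < c₁ → (∀ {x} → x ∈ Bs → c₂ ≤ x) → b₁ ∈ bs →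
    w₁ ∨ w₂ ≡ false × c₁ ∈ cs₁ × c₂ ∉ cs₁ × c₂ ∉ cs₂
  shape⇒label13 D b₁<c₁ B≥c₂ b₁∈ = e , proj₁ hits , proj₂ hits ,
    λ c₂∈ → <-irrefl refl (run-targets> run₂₃′ (proj₂ (∨-false⇒ w₁ w₂ e)) A₂≥c₂ c₂∈)
    where
    e : w₁ ∨ w₂ ≡ false
    e = dominated-run whole (λ z → subst (_≤ cnt (z <ᵇ_) (c₁ ∷ c₂ ∷ Cs)) (cnt-↭ (z ≤ᵇ_) (run-perm run₁₂)) (D z))
    b₁-or-≥c₂ : ∀ {x} → x ∈ b₁ ∷ Bs → x ≡ b₁ ⊎ c₂ ≤ x
    b₁-or-≥c₂ (here x≡b₁) = inj₁ x≡b₁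
    b₁-or-≥c₂ (there x∈)  = inj₂ (B≥c₂ x∈)
    hits : c₁ ∈ cs₁ × c₂ ∉ cs₁
    hits = run-hits-first run₂₃ (proj₁ (∨-false⇒ w₁ w₂ e)) (run-unique run₁₂) b₁∈
      (b₁-or-≥c₂ ∘ run-∈-targets run₁₂) b₁<c₁ c₁<c₂ (here refl) (head≤ sortedC)
    A₂≥c₂ : ∀ {x} → x ∈ A₂ → c₂ ≤ x
    A₂≥c₂ x∈ with b₁-or-≥c₂ (run-∈-rest run₁₂ x∈)
    ... | inj₁ refl = contradiction x∈ (run-fresh run₁₂ b₁∈)
    ... | inj₂ le   = le

-- The procedure follows each path through both rows before the next one starts. Since the rows have
-- separate lists of available entries, this decouples into one run per pair of rows.
path1-run : ∀ {as A₂ bs w A₂′ A₃ cs w′ A₃′} w₀ E₁ E₂ → Run as A₂ bs w A₂′ → Run bs A₃ cs w′ A₃′ →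
  runPaths path1 as (st A₂ A₃ w₀ E₁ E₂) ≡ just (st A₂′ A₃′ (w₀ ∨ w′) (cs ʳ++ E₁) E₂)
path1-run w₀ E₁ E₂ []      []        = cong (λ w → just (st _ _ w E₁ E₂)) (sym (∨-identityʳ w₀))
path1-run w₀ E₁ E₂ (s ∷ r) (_∷_ {y = y} {w = w} {w′} s′ r′) rewrite equation s | equation s′ =
  trans (path1-run (w₀ ∨ w) (y ∷ E₁) E₂ r r′) (cong (λ v → just (st _ _ v _ E₂)) (∨-assoc w₀ w w′))

path2-run : ∀ {bs A₂ A₃ cs w′ A₃′} w₀ E₁ E₂ → Run bs A₃ cs w′ A₃′ →
  runPaths path2 bs (st A₂ A₃ w₀ E₁ E₂) ≡ just (st A₂ A₃′ (w₀ ∨ w′) E₁ (cs ʳ++ E₂))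
path2-run w₀ E₁ E₂ []                                 = cong (λ w → just (st _ _ w E₁ E₂)) (sym (∨-identityʳ w₀))
path2-run w₀ E₁ E₂ (_∷_ {y = y} {w = w} {w′} s r) rewrite equation s =
  trans (path2-run (w₀ ∨ w) E₁ (y ∷ E₂) r) (cong (λ v → just (st _ _ v E₁ _)) (∨-assoc w₀ w w′))

bully-run : ∀ {N} (v : Vec (Fin 3) N) {R₂ R₃ bs w A₂ cs₁ w₁ A₃ cs₂ w₂ A₃′} → rowOf v row2 ≡ R₂ → rowOf v row3 ≡ R₃ →
  Run (rowOf v row1) R₂ bs w A₂ → Run bs R₃ cs₁ w₁ A₃ → Run A₂ A₃ cs₂ w₂ A₃′ →
  bully v ≡ just (st [] A₃′ (w₁ ∨ w₂) (cs₁ ʳ++ []) (cs₂ ʳ++ []))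
bully-run v {w₁ = w₁} refl refl run₁₂ run₂₃ run₂₃′ rewrite path1-run false [] [] run₁₂ run₂₃ = path2-run w₁ _ [] run₂₃′

elemᵇ-ʳ++ : ∀ x L E → elemᵇ x (L ʳ++ E) ≡ elemᵇ x L ∨ elemᵇ x E
elemᵇ-ʳ++ x []      E = refl
elemᵇ-ʳ++ x (y ∷ L) E = trans (elemᵇ-ʳ++ x L (y ∷ E)) (lemma (elemᵇ x L) (x ≡ᵇ y) (elemᵇ x E))
  where
  lemma : ∀ p q r → p ∨ (q ∨ r) ≡ (q ∨ p) ∨ r
  lemma false false r = refl
  lemma false true  r = refl
  lemma true  false r = refl
  lemma true  true  r = refl

elemᵇ-reverse : ∀ x L → elemᵇ x (L ʳ++ []) ≡ elemᵇ x L
elemᵇ-reverse x L = trans (elemᵇ-ʳ++ x L []) (∨-identityʳ _)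

elemᵇ⇒∈ : ∀ x L → elemᵇ x L ≡ true → x ∈ L
elemᵇ⇒∈ x (y ∷ L) e with x ≡ᵇ y in x≡ᵇy
... | true  = here (≡ᵇ-true⇒≡ x y x≡ᵇy)
... | false = there (elemᵇ⇒∈ x L e)

∈⇒elemᵇ : ∀ {x L} → x ∈ L → elemᵇ x L ≡ true
∈⇒elemᵇ {x} {y ∷ L} (here refl) = cong (_∨ elemᵇ x L) (≡ᵇ-refl x)
∈⇒elemᵇ {x} {y ∷ L} (there x∈) with x ≡ᵇ y
... | true  = refl
... | false = ∈⇒elemᵇ x∈

goodRun-label : ∀ {N} (v : Vec (Fin 3) N) {c₁ c₂ Cs A₂ A₃ w E₁ E₂} → bully v ≡ just (st A₂ A₃ w E₁ E₂) →
  rowOf v row3 ≡ c₁ ∷ c₂ ∷ Cs → goodRun v ≡ elemᵇ c₁ E₁ ∧ ((not (elemᵇ c₂ E₁) ∧ not (elemᵇ c₂ E₂)) ∧ not w)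
goodRun-label v {c₁} {c₂} {E₁ = E₁} {E₂} e r₃ rewrite e | r₃ with elemᵇ c₁ E₁
... | true with elemᵇ c₂ E₁
...   | true = refl
...   | false with elemᵇ c₂ E₂
...     | true  = refl
...     | false = refl
goodRun-label v {c₁} {c₂} {E₁ = E₁} {E₂} e r₃ | false with elemᵇ c₁ E₂
...   | true = refl
...   | false = refl

-- Rows of a word in terms of its suffixes and its beginning

length-rowAux : ∀ k w r → length (rowAux k w r) ≡ # r w
length-rowAux k []      r = refl
length-rowAux k (x ∷ w) r with does (x ≟F r)
... | true  = cong suc (length-rowAux (suc k) w r)
... | false = length-rowAux (suc k) w r

rowAux-≥ : ∀ k w r → All (k ≤_) (rowAux k w r)
rowAux-≥ k []      r = []
rowAux-≥ k (x ∷ w) r with does (x ≟F r)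
... | true  = ≤-refl ∷ All.map <⇒≤ (rowAux-≥ (suc k) w r)
... | false = All.map <⇒≤ (rowAux-≥ (suc k) w r)

rowAux-sorted : ∀ k w r → Sorted (rowAux k w r)
rowAux-sorted k []      r = []
rowAux-sorted k (x ∷ w) r with does (x ≟F r)
... | true  = rowAux-≥ (suc k) w r ∷ rowAux-sorted (suc k) w r
... | false = rowAux-sorted (suc k) w r

cnt-length : ∀ p xs → (∀ {x} → x ∈ xs → p x ≡ true) → cnt p xs ≡ length xs
cnt-length p []       h = refl
cnt-length p (x ∷ xs) h rewrite h (here refl) = cong suc (cnt-length p xs (h ∘ there))

cnt-≥ : ∀ z k w r → z ≤ k → cnt (z ≤ᵇ_) (rowAux k w r) ≡ # r w
cnt-≥ z k w r z≤k = trans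
  (cnt-length (z ≤ᵇ_) _ (λ u∈ → ≤⇒≤ᵇ-true (≤-trans z≤k (All.lookup (rowAux-≥ k w r) u∈)))) (length-rowAux k w r)

cnt-> : ∀ z k w r → z < k → cnt (z <ᵇ_) (rowAux k w r) ≡ # r w
cnt-> z k w r z<k = trans
  (cnt-length (z <ᵇ_) _ (λ u∈ → <⇒<ᵇ-true (<-≤-trans z<k (All.lookup (rowAux-≥ k w r) u∈)))) (length-rowAux k w r)

cnt-tail≤ : ∀ p k x w r → cnt p (rowAux (suc k) w r) ≤ cnt p (rowAux k (x ∷ w) r)
cnt-tail≤ p k x w r with does (x ≟F r)
... | true  = m≤n+m _ (indicator (p k))
... | false = ≤-refl

cnt-tail≡ : ∀ p k x w r → p k ≡ false → cnt p (rowAux k (x ∷ w) r) ≡ cnt p (rowAux (suc k) w r)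
cnt-tail≡ p k x w r pk with does (x ≟F r)
... | true rewrite pk = refl
... | false = refl

≮⇒<ᵇ-false : ∀ {m n} → ¬ (m < n) → (m <ᵇ n) ≡ false
≮⇒<ᵇ-false m≮n = ¬-not {y = true} (m≮n ∘ <ᵇ-true⇒<)

RowDominated : Fin 3 → Fin 3 → ℕ → Word → Set
RowDominated r r′ k w = Dominated (rowAux k w r) (rowAux k w r′)

rowDominated-tail : ∀ r r′ k x w → RowDominated r r′ k (x ∷ w) → RowDominated r r′ (suc k) w
rowDominated-tail r r′ k x w D z with z <? k
... | no z≮k = ≤-trans (cnt-tail≤ (z ≤ᵇ_) k x w r)
  (≤-trans (D z) (≤-reflexive (cnt-tail≡ (z <ᵇ_) k x w r′ (≮⇒<ᵇ-false z≮k))))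
... | yes z<k = begin
  cnt (z ≤ᵇ_) (rowAux (suc k) w r)  ≡⟨ cnt-≥ z (suc k) w r (<⇒≤ (m≤n⇒m≤1+n z<k)) ⟩
  # r w                             ≡⟨ cnt-≥ k (suc k) w r (n≤1+n k) ⟨
  cnt (k ≤ᵇ_) (rowAux (suc k) w r)  ≤⟨ cnt-tail≤ (k ≤ᵇ_) k x w r ⟩
  cnt (k ≤ᵇ_) (rowAux k (x ∷ w) r)  ≤⟨ D k ⟩
  cnt (k <ᵇ_) (rowAux k (x ∷ w) r′) ≡⟨ cnt-tail≡ (k <ᵇ_) k x w r′ (≮⇒<ᵇ-false {k} (<-irrefl refl)) ⟩
  cnt (k <ᵇ_) (rowAux (suc k) w r′) ≡⟨ cnt-> k (suc k) w r′ ≤-refl ⟩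
  # r′ w                            ≡⟨ cnt-> z (suc k) w r′ (m≤n⇒m≤1+n z<k) ⟨
  cnt (z <ᵇ_) (rowAux (suc k) w r′) ∎
  where open ≤-Reasoning

rowDominated-# : ∀ r r′ k x w → RowDominated r r′ k (x ∷ w) → # r (x ∷ w) ≤ # r′ w
rowDominated-# r r′ k x w D = begin
  # r (x ∷ w)                       ≡⟨ cnt-≥ k k (x ∷ w) r ≤-refl ⟨
  cnt (k ≤ᵇ_) (rowAux k (x ∷ w) r)  ≤⟨ D k ⟩
  cnt (k <ᵇ_) (rowAux k (x ∷ w) r′) ≡⟨ cnt-tail≡ (k <ᵇ_) k x w r′ (≮⇒<ᵇ-false {k} (<-irrefl refl)) ⟩
  cnt (k <ᵇ_) (rowAux (suc k) w r′) ≡⟨ cnt-> k (suc k) w r′ ≤-refl ⟩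
  # r′ w                            ∎
  where open ≤-Reasoning

rowDominated-∷ : ∀ r r′ k x w → # r (x ∷ w) ≤ # r′ w → RowDominated r r′ (suc k) w → RowDominated r r′ k (x ∷ w)
rowDominated-∷ r r′ k x w le D z with z ≤? k
... | yes z≤k = begin
  cnt (z ≤ᵇ_) (rowAux k (x ∷ w) r)  ≡⟨ cnt-≥ z k (x ∷ w) r z≤k ⟩
  # r (x ∷ w)                       ≤⟨ le ⟩
  # r′ w                            ≡⟨ cnt-> z (suc k) w r′ (s≤s z≤k) ⟨
  cnt (z <ᵇ_) (rowAux (suc k) w r′) ≤⟨ cnt-tail≤ (z <ᵇ_) k x w r′ ⟩
  cnt (z <ᵇ_) (rowAux k (x ∷ w) r′) ∎
  where open ≤-Reasoning
... | no z≰k = begin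
  cnt (z ≤ᵇ_) (rowAux k (x ∷ w) r)  ≡⟨ cnt-tail≡ (z ≤ᵇ_) k x w r (¬-not {y = true} (z≰k ∘ ≤ᵇ-true⇒≤)) ⟩
  cnt (z ≤ᵇ_) (rowAux (suc k) w r)  ≤⟨ D z ⟩
  cnt (z <ᵇ_) (rowAux (suc k) w r′) ≤⟨ cnt-tail≤ (z <ᵇ_) k x w r′ ⟩
  cnt (z <ᵇ_) (rowAux k (x ∷ w) r′) ∎
  where open ≤-Reasoning

-- Hall's condition at `z` compares the letters `r` from position `z` on with the letters `r′`
-- strictly after it. If the letter at `z` is `r`, this is the inequality that `suffixBallot` checks
-- there; otherwise it is the ballot condition of the following suffix.
rowDominated⇒ballot : ∀ r r′ k w → RowDominated r r′ k w → suffixBallot r r′ w ≡ true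
rowDominated⇒ballot r r′ k []      D = refl
rowDominated⇒ballot r r′ k (x ∷ w) D
  rewrite rowDominated⇒ballot r r′ (suc k) w (rowDominated-tail r r′ k x w D) with does
    (x ≟F r) | rowDominated-# r r′ k x w D
... | true  | le rewrite <⇒<ᵇ-true le = refl
... | false | _ = refl

ballot⇒rowDominated : ∀ r r′ k w → suffixBallot r r′ w ≡ true → RowDominated r r′ k w
ballot⇒rowDominated r r′ k []      e z = z≤n
ballot⇒rowDominated r r′ k (x ∷ w) e = rowDominated-∷ r r′ k x w total tail
  where
  split = ∧-true⇒ (not (does (x ≟F r)) ∨ (# r w <ᵇ # r′ w)) (suffixBallot r r′ w) e
  tail : RowDominated r r′ (suc k) w
  tail = ballot⇒rowDominated r r′ (suc k) w (proj₂ split)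
  total : # r (x ∷ w) ≤ # r′ w
  total with does (x ≟F r) | proj₁ split
  ... | true  | lt = <ᵇ-true⇒< lt
  ... | false | _  = subst₂ _≤_ (cnt-≥ k (suc k) w r (n≤1+n k)) (cnt-> k (suc k) w r′ ≤-refl) (tail k)

rowAux-∈≥ : ∀ k w r {u} → u ∈ rowAux k w r → k ≤ u
rowAux-∈≥ k w r = All.lookup (rowAux-≥ k w r)

∈-head : ∀ {x : ℕ} {xs L} → L ≡ x ∷ xs → x ∈ L
∈-head refl = here refl

startsC⇒≥ : ∀ k w {c₁ Cs} → rowAux k w c ≡ c₁ ∷ Cs → startsC w ≡ true → ∀ {u} → u ∈ rowAux k w b → c₁ ≤ u
startsC⇒≥ k (a ∷ w) e    s u∈ = startsC⇒≥ (suc k) w e s u∈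
startsC⇒≥ k (c ∷ w) refl s u∈ = <⇒≤ (rowAux-∈≥ (suc k) w b u∈)

≥⇒startsC : ∀ k w {c₁ Cs} → rowAux k w c ≡ c₁ ∷ Cs → (∀ {u} → u ∈ rowAux k w b → c₁ ≤ u) → startsC w ≡ true
≥⇒startsC k (a ∷ w) e h = ≥⇒startsC (suc k) w e h
≥⇒startsC k (b ∷ w) e h = contradiction (rowAux-∈≥ (suc k) w c (∈-head e)) (≤⇒≯ (h (here refl)))
≥⇒startsC k (c ∷ w) e h = refl

startsCC⇒≥ : ∀ k w {c₁ c₂ Cs} → rowAux k w c ≡ c₁ ∷ c₂ ∷ Cs → startsCC w ≡ true → ∀ {u} → u ∈ rowAux k w b → c₂ ≤ u
startsCC⇒≥ k (a ∷ w) e s u∈ = startsCC⇒≥ (suc k) w e s u∈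
startsCC⇒≥ k (c ∷ w) e s u∈ = startsC⇒≥ (suc k) w (∷-injectiveʳ e) s u∈

≥⇒startsCC : ∀ k w {c₁ c₂ Cs} → rowAux k w c ≡ c₁ ∷ c₂ ∷ Cs → (∀ {u} → u ∈ rowAux k w b → c₂ ≤ u) → startsCC w ≡ true
≥⇒startsCC k (a ∷ w) e h = ≥⇒startsCC (suc k) w e h
≥⇒startsCC k (b ∷ w) e h = contradiction
  (rowAux-∈≥ (suc k) w c (subst (_ ∈_) (sym e) (there (here refl)))) (≤⇒≯ (h (here refl)))
≥⇒startsCC k (c ∷ w) e h = ≥⇒startsC (suc k) w (∷-injectiveʳ e) h

startsBCC⇒≥ : ∀ k w {b₁ Bs c₁ c₂ Cs} → rowAux k w b ≡ b₁ ∷ Bs → rowAux k w c ≡ c₁ ∷ c₂ ∷ Cs → startsBCC w ≡ true →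
  b₁ < c₁ × (∀ {u} → u ∈ Bs → c₂ ≤ u)
startsBCC⇒≥ k (a ∷ w) e    e′ s = startsBCC⇒≥ (suc k) w e e′ s
startsBCC⇒≥ k (c ∷ w) e    e′ ()
startsBCC⇒≥ k (b ∷ w) refl e′ s = rowAux-∈≥ (suc k) w c (∈-head e′) , startsCC⇒≥ (suc k) w e′ s

≥⇒startsBCC : ∀ k w {b₁ Bs c₁ c₂ Cs} → rowAux k w b ≡ b₁ ∷ Bs → rowAux k w c ≡ c₁ ∷ c₂ ∷ Cs →
  b₁ < c₁ → (∀ {u} → u ∈ Bs → c₂ ≤ u) → startsBCC w ≡ true
≥⇒startsBCC k (a ∷ w) e    e′ lt h = ≥⇒startsBCC (suc k) w e e′ lt h
≥⇒startsBCC k (b ∷ w) refl e′ lt h = ≥⇒startsCC (suc k) w e′ h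
≥⇒startsBCC k (c ∷ w) e    e′ lt h = contradiction lt
  (<⇒≯ (subst (_< _) (∷-injectiveˡ e′) (rowAux-∈≥ (suc k) w b (∈-head e))))

lastInRow3≡endsInC : ∀ {N} (v : Vec (Fin 3) (suc N)) → lastInRow3 v ≡ endsInC (toList v)
lastInRow3≡endsInC (x ∷ v) = go 1 x (toList v)
  where
  notLast : ∀ k n → (k + suc n ≡ᵇ k) ≡ false
  notLast zero    n = refl
  notLast (suc k) n = notLast k n
  skip : ∀ k x w n → elemᵇ (k + suc n) (rowAux k (x ∷ w) c) ≡ elemᵇ (k + suc n) (rowAux (suc k) w c)
  skip k x w n with does (x ≟F c)
  ... | true  = cong (_∨ elemᵇ (k + suc n) (rowAux (suc k) w c)) (notLast k n)
  ... | false = refl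
  go : ∀ k x w → elemᵇ (k + length w) (rowAux k (x ∷ w) c) ≡ endsInC (x ∷ w)
  go k a []      = refl
  go k b []      = refl
  go k c []      rewrite +-identityʳ k | ≡ᵇ-refl k = refl
  go k x (y ∷ w) = trans (skip k x (y ∷ w) (length w))
    (trans (cong (λ n → elemᵇ n (rowAux (suc k) (y ∷ w) c)) (+-suc k (length w))) (go (suc k) y w))

-- Comparison of the bully procedure with `good`

uncons : ∀ (L : List ℕ) → 1 ≤ length L → ∃₂ λ x xs → L ≡ x ∷ xs
uncons (x ∷ xs) _ = x , xs , refl

uncons₂ : ∀ (L : List ℕ) → 2 ≤ length L → ∃₂ λ x y → ∃ λ xs → L ≡ x ∷ y ∷ xs
uncons₂ (x ∷ y ∷ xs) _ = x , y , xs , refl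
uncons₂ (x ∷ [])     (s≤s ())

true-ext : ∀ {p q} → (p ≡ true → q ≡ true) → (q ≡ true → p ≡ true) → p ≡ q
true-ext {true}  {q}     f g = sym (f refl)
true-ext {false} {false} f g = refl
true-ext {false} {true}  f g = g refl

not-true⇒false : ∀ {p} → not p ≡ true → p ≡ false
not-true⇒false {false} _ = refl

elemᵇ-false⇒∉ : ∀ {x L} → elemᵇ x L ≡ false → x ∉ L
elemᵇ-false⇒∉ e x∈ = contradiction (trans (sym (∈⇒elemᵇ x∈)) e) λ ()

∉⇒elemᵇ-false : ∀ {x L} → x ∉ L → elemᵇ x L ≡ false
∉⇒elemᵇ-false {x} {L} x∉ = ¬-not {y = true} (x∉ ∘ elemᵇ⇒∈ x L)

label13-true⇒ : ∀ p q r w → p ∧ ((not q ∧ not r) ∧ not w) ≡ true → p ≡ true × q ≡ false × r ≡ false × w ≡ false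
label13-true⇒ true false false false _ = refl , refl , refl , refl

⇒label13-true : ∀ p q r w → p ≡ true → q ≡ false → r ≡ false → w ≡ false → p ∧ ((not q ∧ not r) ∧ not w) ≡ true
⇒label13-true _ _ _ _ refl refl refl refl = refl

module _ {N : ℕ} (v : Vec (Fin 3) N) {b₁ c₁ c₂ : ℕ} {Bs Cs : List ℕ} (row₂ : rowOf v row2 ≡ b₁ ∷ Bs)
  (row₃ : rowOf v row3 ≡ c₁ ∷ c₂ ∷ Cs)
  (s≤m : # a (toList v) ≤ # b (toList v)) (m≤n : # b (toList v) ≤ # c (toList v)) where

  private
    sortedB : Sorted (b₁ ∷ Bs)
    sortedB = subst Sorted row₂ (rowAux-sorted 1 (toList v) b)
    sortedC : Sorted (c₁ ∷ c₂ ∷ Cs)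
    sortedC = subst Sorted row₃ (rowAux-sorted 1 (toList v) c)
    |R₂| : length (b₁ ∷ Bs) ≡ # b (toList v)
    |R₂| = trans (cong length (sym row₂)) (length-rowAux 1 (toList v) b)
    |R₃| : length (c₁ ∷ c₂ ∷ Cs) ≡ # c (toList v)
    |R₃| = trans (cong length (sym row₃)) (length-rowAux 1 (toList v) c)
    |R₁|≤|R₂| : length (rowOf v row1) ≤ length (b₁ ∷ Bs)
    |R₁|≤|R₂| = subst₂ _≤_ (sym (length-rowAux 1 (toList v) a)) (sym |R₂|) s≤m
    |R₂|≤|R₃| : length (b₁ ∷ Bs) ≤ length (c₁ ∷ c₂ ∷ Cs)
    |R₂|≤|R₃| = subst₂ _≤_ (sym |R₂|) (sym |R₃|) m≤n

    module _ {bs A₂ cs₁ A₃ cs₂ A₃′ : List ℕ} {w w₁ w₂ : Bool} (run₁₂ : Run (rowOf v row1) (b₁ ∷ Bs) bs w A₂)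
      (run₂₃ : Run bs (c₁ ∷ c₂ ∷ Cs) cs₁ w₁ A₃) (run₂₃′ : Run A₂ A₃ cs₂ w₂ A₃′) where

      labels : goodRun v ≡ elemᵇ c₁ cs₁ ∧ ((not (elemᵇ c₂ cs₁) ∧ not (elemᵇ c₂ cs₂)) ∧ not (w₁ ∨ w₂))
      labels = trans (goodRun-label v (bully-run v row₂ row₃ run₁₂ run₂₃ run₂₃′) row₃)
        (cong₂ _∧_ (elemᵇ-reverse c₁ cs₁) (cong (_∧ not (w₁ ∨ w₂))
          (cong₂ (λ p q → not p ∧ not q) (elemᵇ-reverse c₂ cs₁) (elemᵇ-reverse c₂ cs₂))))

      goodRun⇒shape : goodRun v ≡ true → Shape b₁ Bs c₁ c₂ Cs bs
      goodRun⇒shape e with label13-true⇒ (elemᵇ c₁ cs₁) (elemᵇ c₂ cs₁) (elemᵇ c₂ cs₂) (w₁ ∨ w₂) (trans (sym labels) e)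
      ... | ∈₁ , ∉₁ , ∉₂ , nowrap = label13⇒shape sortedB sortedC run₁₂ run₂₃ run₂₃′ nowrap
        (elemᵇ⇒∈ c₁ cs₁ ∈₁) (elemᵇ-false⇒∉ ∉₁) (elemᵇ-false⇒∉ ∉₂)

      shape⇒goodRun : Shape b₁ Bs c₁ c₂ Cs bs → goodRun v ≡ true
      shape⇒goodRun (D , b₁<c₁ , Bs≥c₂ , b₁∈) with shape⇒label13 sortedB sortedC run₁₂ run₂₃ run₂₃′ D b₁<c₁ Bs≥c₂ b₁∈
      ... | nowrap , ∈₁ , ∉₁ , ∉₂ = trans labels
        (⇒label13-true (elemᵇ c₁ cs₁) (elemᵇ c₂ cs₁) (elemᵇ c₂ cs₂) (w₁ ∨ w₂) (∈⇒elemᵇ ∈₁) (∉⇒elemᵇ-false ∉₁)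
          (∉⇒elemᵇ-false ∉₂) nowrap)

  -- The row lengths increase weakly, so an available entry is always left and all three runs exist.
  -- `bs` is returned with its run because the last clause of `Shape` still has to be decided from
  -- the first letter of the word.
  goodRun⇔shape : ∃ λ bs → ∃ λ w → ∃ λ A₂ → Run (rowOf v row1) (b₁ ∷ Bs) bs w A₂ ×
    (goodRun v ≡ true → Shape b₁ Bs c₁ c₂ Cs bs) × (Shape b₁ Bs c₁ c₂ Cs bs → goodRun v ≡ true)
  goodRun⇔shape
    with bs , w , A₂ , run₁₂ ← run (rowOf v row1) (b₁ ∷ Bs) sortedB |R₁|≤|R₂|
    with cs₁ , w₁ , A₃ , run₂₃ ← run bs (c₁ ∷ c₂ ∷ Cs) sortedC
      (≤-trans (≤-trans (≤-reflexive (sym (run-length run₁₂))) |R₁|≤|R₂|) |R₂|≤|R₃|)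
    with cs₂ , w₂ , A₃′ , run₂₃′ ← run A₂ A₃ (run-sorted sortedC run₂₃)
      (+-cancelˡ-≤ (length bs) _ _ (subst₂ _≤_
        (trans (run-length-rest run₁₂) (cong (_+ length A₂) (run-length run₁₂))) (run-length-rest run₂₃) |R₂|≤|R₃|))
    = bs , w , A₂ , run₁₂ , goodRun⇒shape run₁₂ run₂₃ run₂₃′ , shape⇒goodRun run₁₂ run₂₃ run₂₃′

shape⇒good-a : ∀ {N} (v : Vec (Fin 3) N) {b₁ Bs c₁ c₂ Cs bs} →
  rowOf (a ∷ v) row2 ≡ b₁ ∷ Bs → rowOf (a ∷ v) row3 ≡ c₁ ∷ c₂ ∷ Cs →
  Shape b₁ Bs c₁ c₂ Cs bs → good (a ∷ toList v) ≡ true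
shape⇒good-a v row₂ row₃ (D , b₁<c₁ , Bs≥c₂ , _) = cong₂ _∧_
  (≥⇒startsBCC 2 (toList v) row₂ row₃ b₁<c₁ Bs≥c₂)
  (rowDominated⇒ballot b c 2 (toList v) (subst₂ Dominated (sym row₂) (sym row₃) D))

good⇒shape-a : ∀ {N} (v : Vec (Fin 3) N) {b₁ Bs c₁ c₂ Cs bs w A₂} →
  rowOf (a ∷ v) row2 ≡ b₁ ∷ Bs → rowOf (a ∷ v) row3 ≡ c₁ ∷ c₂ ∷ Cs →
  Run (rowOf (a ∷ v) row1) (b₁ ∷ Bs) bs w A₂ → good (a ∷ toList v) ≡ true → Shape b₁ Bs c₁ c₂ Cs bs
good⇒shape-a v {b₁} {Bs} {c₁} {c₂} row₂ row₃ run₁₂ e =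
  subst₂ Dominated row₂ row₃ (ballot⇒rowDominated b c 2 (toList v) (proj₂ bcc×bal)) ,
  proj₁ separated , proj₂ separated ,
  -- Entry 1 bullies first and lies below all of row 2, so it takes `b₁`.
  run-starts-below⇒least run₁₂ (rowAux-∈≥ 2 (toList v) b (∈-head row₂)) (here refl)
    (head≤ (subst Sorted row₂ (rowAux-sorted 2 (toList v) b)))
  where
  bcc×bal : startsBCC (toList v) ≡ true × suffixBallot b c (toList v) ≡ true
  bcc×bal = ∧-true⇒ (startsBCC (toList v)) (suffixBallot b c (toList v)) e
  separated : b₁ < c₁ × (∀ {x} → x ∈ Bs → c₂ ≤ x)
  separated = startsBCC⇒≥ 2 (toList v) row₂ row₃ (proj₁ bcc×bal)

module _ {N : ℕ} (v : Vec (Fin 3) N) {c₁ c₂ : ℕ} {Cs bs A₂ : List ℕ} {w : Bool}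
  (row₃ : rowOf (b ∷ v) row3 ≡ c₁ ∷ c₂ ∷ Cs) (run₁₂ : Run (rowOf (b ∷ v) row1) (rowOf (b ∷ v) row2) bs w A₂) where

  shape⇒good-b : Shape 1 (rowAux 2 (toList v) b) c₁ c₂ Cs bs → good (b ∷ toList v) ≡ true
  shape⇒good-b (D , _ , Bs≥c₂ , b₁∈) = cong₂ _∧_
    (cong₂ _∧_ (≥⇒startsCC 2 (toList v) row₃ Bs≥c₂)
      (rowDominated⇒ballot b c 1 (b ∷ toList v) (subst (Dominated (rowAux 1 (b ∷ toList v) b)) (sym row₃) D)))
    -- Without wrapping, every entry hit from row 1 exceeds 1, which is the first entry of row 2.
    (cong not (¬-not {y = true} λ e → <-irrefl refl (run-targets> run₁₂
      (dominated-run run₁₂ (ballot⇒rowDominated a b 1 (b ∷ toList v) e))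
        (λ x∈ → <⇒≤ (rowAux-∈≥ 2 (toList v) a x∈)) b₁∈)))

  good⇒shape-b : good (b ∷ toList v) ≡ true → Shape 1 (rowAux 2 (toList v) b) c₁ c₂ Cs bs
  good⇒shape-b e = subst (Dominated (rowAux 1 (b ∷ toList v) b)) row₃
    (ballot⇒rowDominated b c 1 (b ∷ toList v) (proj₂ cc×bal)) ,
    rowAux-∈≥ 2 (toList v) c (∈-head row₃) , startsCC⇒≥ 2 (toList v) row₃ (proj₁ cc×bal) ,
    -- Failure of the ballot condition forces a wrapping into row 2, and the least entry there is 1.
    run-wraps⇒least run₁₂ (¬-not {y = false} wrapped) (here refl) (head≤ (rowAux-sorted 1 (b ∷ toList v) b))
    where
    parts : startsCC (toList v) ∧ suffixBallot b c (b ∷ toList v) ≡ true × not (suffixBallot a b (toList v)) ≡ true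
    parts = ∧-true⇒ (startsCC (toList v) ∧ suffixBallot b c (b ∷ toList v)) (not (suffixBallot a b (toList v))) e
    cc×bal : startsCC (toList v) ≡ true × suffixBallot b c (b ∷ toList v) ≡ true
    cc×bal = ∧-true⇒ (startsCC (toList v)) (suffixBallot b c (b ∷ toList v)) (proj₁ parts)
    wrapped : ¬ w ≡ false
    wrapped nowrap = contradiction
      (trans (sym (not-true⇒false (proj₂ parts)))
        (rowDominated⇒ballot a b 1 (b ∷ toList v) (run-dominated w nowrap run₁₂))) λ ()

¬shape-c : ∀ {N} (v : Vec (Fin 3) N) {b₁ Bs c₁ c₂ Cs bs} → rowOf (c ∷ v) row2 ≡ b₁ ∷ Bs → rowOf
  (c ∷ v) row3 ≡ c₁ ∷ c₂ ∷ Cs →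
  ¬ Shape b₁ Bs c₁ c₂ Cs bs
¬shape-c v row₂ row₃ (_ , b₁<c₁ , _) =
  <⇒≯ (subst (_< _) (∷-injectiveˡ row₃) (rowAux-∈≥ 2 (toList v) b (∈-head row₂))) b₁<c₁

goodRun≡good-rows : ∀ {N} (v : Vec (Fin 3) N) {b₁ Bs c₁ c₂ Cs} → rowOf v row2 ≡ b₁ ∷ Bs →
  rowOf v row3 ≡ c₁ ∷ c₂ ∷ Cs →
  # a (toList v) ≤ # b (toList v) → # b (toList v) ≤ # c (toList v) → goodRun v ≡ good (toList v)
goodRun≡good-rows (a ∷ v) row₂ row₃ s≤m m≤n =
  let _ , _ , _ , run₁₂ , to , from = goodRun⇔shape (a ∷ v) row₂ row₃ s≤m m≤n in
  true-ext {goodRun (a ∷ v)} (λ e → shape⇒good-a v row₂ row₃ (to e)) (λ e → from (good⇒shape-a v row₂ row₃ run₁₂ e))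
goodRun≡good-rows (b ∷ v) refl row₃ s≤m m≤n =
  let _ , _ , _ , run₁₂ , to , from = goodRun⇔shape (b ∷ v) refl row₃ s≤m m≤n in
  true-ext {goodRun (b ∷ v)} (λ e → shape⇒good-b v row₃ run₁₂ (to e)) (λ e → from (good⇒shape-b v row₃ run₁₂ e))
goodRun≡good-rows (c ∷ v) row₂ row₃ s≤m m≤n =
  let _ , _ , _ , _ , to , _ = goodRun⇔shape (c ∷ v) row₂ row₃ s≤m m≤n in
  true-ext {goodRun (c ∷ v)} (λ e → contradiction (to e) (¬shape-c v row₂ row₃)) λ ()

goodRun≡good : ∀ {N} (v : Vec (Fin 3) N) → # a (toList v) ≤ # b (toList v) → # b (toList v) ≤ # c (toList v) →
  1 ≤ # b (toList v) → 2 ≤ # c (toList v) → goodRun v ≡ good (toList v)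
goodRun≡good v s≤m m≤n 1≤m 2≤n =
  let _ , _ , row₂     = uncons (rowOf v row2) (subst (1 ≤_) (sym (length-rowAux 1 (toList v) b)) 1≤m)
      _ , _ , _ , row₃ = uncons₂ (rowOf v row3) (subst (2 ≤_) (sym (length-rowAux 1 (toList v) c)) 2≤n)
  in goodRun≡good-rows v row₂ row₃ s≤m m≤n

-- Assembly of the formula

hasType≡hasCounts : ∀ {N} s t n (v : Vec (Fin 3) N) → hasType s t n v ≡ hasCounts s (s + t) n (toList v)
hasType≡hasCounts s t n v = cong₂ _∧_ (cong (_≡ᵇ s) (length-rowAux 1 (toList v) a))
  (cong₂ _∧_ (cong (_≡ᵇ (s + t)) (length-rowAux 1 (toList v) b)) (cong (_≡ᵇ n) (length-rowAux 1 (toList v) c)))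

isCounted≡ : ∀ {N} s t n → 1 ≤ s + t → s + t < n → (v : Vec (Fin 3) (suc N)) →
  isCounted s t n v ≡ hasCounts s (s + t) n (toList v) ∧ (endsInC ∩ good) (toList v)
isCounted≡ s t n 1≤m m<n v rewrite hasType≡hasCounts s t n v with hasCounts s (s + t) n (toList v) in e
... | false = refl
... | true with hasCounts⇒≡ s (s + t) n (toList v) e
...   | #a , #b , #c = cong₂ _∧_ (lastInRow3≡endsInC v) (goodRun≡good v
  (subst₂ _≤_ (sym #a) (sym #b) (m≤m+n s t)) (subst₂ _≤_ (sym #b) (sym #c) (<⇒≤ m<n))
  (subst (1 ≤_) (sym #b) 1≤m) (subst (2 ≤_) (sym #c) (≤-trans (s≤s 1≤m) m<n)))

-- Pascal's rule splits both binomials, and the common term `n C (k − 1)` cancels; the lower indices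
-- s - 1 and s - 3 appear with s = `suc k`.
ballot≡binomℤ : ∀ n k → ballot (suc n) k ≡ + binomℤ n (+ suc k - + 1) - + binomℤ n (+ suc k - + 3)
ballot≡binomℤ n zero = trans (ballot-zero (suc n)) (sym (ballot-zero n))
ballot≡binomℤ n (suc k) = trans
  (cong₂ _-_ (pascal n k) (pascal⁻ n k))
  (trans (lemma (+ (n C k)) (+ (n C suc k)) (+ (n C⁻ k))) (cong (λ x → + (n C suc k) - + x) (C⁻≡binomℤ k)))
  where
  lemma : ∀ x y z → (x +ℤ y) - (z +ℤ x) ≡ y - z
  lemma = solve-∀
  C⁻≡binomℤ : ∀ k → n C⁻ k ≡ binomℤ n (+ suc (suc k) - + 3)
  C⁻≡binomℤ zero    = refl
  C⁻≡binomℤ (suc k) = refl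

theorem5p2 : (s t n : ℕ) → 1 ≤ s → 1 ≤ t → s + t < n →
    + alpha13 s t n ≡
    (+ binomℤ (n + 2 * s + t ∸ 2) (+ s - + 1) - + binomℤ (n + 2 * s + t ∸ 2) (+ s - + 3))
    *ℤ + fSYT (n ∸ 1) (s + t)
theorem5p2 (suc i) (suc t) (suc (suc k)) _ _ (s≤s (s≤s j≤k)) = begin
  + alpha13 (suc i) (suc t) (suc (suc k))
    ≡⟨ cong +_ (filter-cong (isCounted≡ (suc i) (suc t) (suc (suc k)) (s≤s z≤n) (s≤s (s≤s j≤k)))
         (allVecs (suc (suc k) + 2 * suc i + suc t))) ⟩
  + countOf (endsInC ∩ good) (suc i) (suc j) (suc (suc k)) (suc (suc k) + 2 * suc i + suc t)
    ≡⟨ cong (λ N → + countOf (endsInC ∩ good) (suc i) (suc j) (suc (suc k)) N) N≡ ⟩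
  + countOf (endsInC ∩ good) (suc i) (suc j) (suc (suc k)) (suc (i + suc (suc (suc (suc M)))))
    -- The last argument, `suc i ≤ j`, says s ≤ s + t - 1 and holds because t ≥ 1; it keeps the
    -- excluded lattice words within the range of `words-CC-lattice`.
    ≡⟨ words-good j k M (cong (_+ k) (+-suc i t)) (m≤n⇒m≤1+n j≤k) i
         (≤-trans (s≤s (m≤m+n i t)) (≤-reflexive (sym (+-suc i t)))) ⟩
  ballot (i + suc (suc (suc (suc M)))) i *ℤ ballot (suc j + suc k) (suc j)
    ≡⟨ cong (λ n → ballot n i *ℤ ballot (suc j + suc k) (suc j)) (+-suc i (suc (suc (suc M)))) ⟩
  ballot (suc L) i *ℤ ballot (suc j + suc k) (suc j)
    ≡⟨ cong₂ _*ℤ_ (ballot≡binomℤ L i) (ballot≡fSYT (suc k) (suc j) (s≤s j≤k)) ⟩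
  (+ binomℤ L (+ suc i - + 1) - + binomℤ L (+ suc i - + 3)) *ℤ + fSYT (suc k) (suc j)
    ≡⟨ cong (λ n → (+ binomℤ n (+ suc i - + 1) - + binomℤ n (+ suc i - + 3)) *ℤ + fSYT (suc k) (suc j))
         (cong (_∸ 2) (trans N≡ (cong suc (+-suc i (suc (suc (suc M))))))) ⟨
  _ ∎
  where
  open ≡-Reasoning
  j M L : ℕ
  -- In terms of the theorem `i` is s - 1, `j` is s + t - 1, `k` is n - 2, `suc M` is `j + k`, and
  -- `L` is N - 2.
  j = i + suc t
  M = i + t + k
  L = i + suc (suc (suc M))
  arith : ∀ i t k → 2 + k + 2 * (1 + i) + (1 + t) ≡ 1 + (i + (4 + (i + t + k)))
  arith = ℕ-Solver.solve-∀
  N≡ : suc (suc k) + 2 * suc i + suc t ≡ suc (i + suc (suc (suc (suc M))))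
  N≡ = arith i t k
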